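{- Let $D$ be a positive integer. If $G$ is a graph with $\mathrm{mad}(G)<4$ and $\Delta(G)\le D$, then $\omega(G^2)\le \frac52 D+532$.
   Context: The maximum average degree of $G$ is $\mathrm{mad}(G)=\max_{H\subseteq G} 2|E(H)|/|V(H)|$ over nonempty subgraphs $H$. The square $G^2$ of $G$ is obtained from $G$ by adding an edge between every pair of vertices at distance 2 in $G$. $\omega(\cdot)$ denotes clique number and $\Delta(\cdot)$ maximum degree. -}

module Defs where

open import Data.Fin.Base using (Fin; _<_)
open import Data.Fin.Properties using (_≟_; _<?_; any?; all?)
open import Data.Fin.Subset using (Subset; inside; outside; _∈_; ∣_∣; Nonempty)
open import Data.Fin.Subset.Properties using (_∈?_; nonempty?)
open import Data.Integer.Base using (+_)
open import Data.List.Base using (List; []; _∷_; _++_; map; mapMaybe; filter; allFin; cartesianProduct; length; lookup)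
import Data.List.Extrema as Extrema
import Data.List.Extrema.Nat as Extremaℕ
import Data.Maybe.Base as Maybe
open import Data.Nat.Base as ℕ using (ℕ; zero; suc; NonZero)
import Data.Nat.Properties as ℕ
open import Data.Product.Base using (_×_; _,_; ∃; proj₁; proj₂)
open import Data.Rational.Base using (ℚ; 0ℚ; _/_)
open import Data.Rational.Properties using (≤-decTotalOrder)
open import Data.Sum.Base using (_⊎_; inj₁; inj₂)
open import Data.Vec.Base using ([]; _∷_; tabulate; here; there)
open import Level using (0ℓ)
open import Relation.Binary.Bundles using (DecTotalOrder)
open import Relation.Binary.Core using (Rel)
open import Relation.Binary.Definitions using (Decidable; Symmetric; Irreflexive)
open import Relation.Binary.PropositionalEquality using (_≡_; _≢_; refl)
open import Relation.Nullary.Decidable using (Dec; does; _×-dec_; _⊎-dec_; _→-dec_; ¬?; dec⇒maybe)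
open import Relation.Nullary.Negation using (¬_)

module Extremaℚ = Extrema (DecTotalOrder.totalOrder ≤-decTotalOrder)

-- Finite simple graphs. Decidability of adjacency is part of the data because
-- the numerical invariants below count vertices and edges.

record Graph (n : ℕ) : Set₁ where
  infix 4 _~_ _~?_
  field
    _~_      : Rel (Fin n) 0ℓ
    _~?_     : Decidable _~_
    ~-sym    : Symmetric _~_
    ~-irrefl : Irreflexive _≡_ _~_

subsets : ∀ n → List (Subset n)
subsets zero    = [] ∷ []
subsets (suc n) = map (inside ∷_) (subsets n) ++ map (outside ∷_) (subsets n)

∈⇒nonZero : ∀ {n} {x : Fin n} {p : Subset n} → x ∈ p → NonZero ∣ p ∣
∈⇒nonZero                   here        = _
∈⇒nonZero {p = inside  ∷ _} (there _)   = _
∈⇒nonZero {p = outside ∷ _} (there x∈p) = ∈⇒nonZero x∈p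

module _ {n : ℕ} (G : Graph n) where
  open Graph G

  neighbours : Fin n → Subset n
  neighbours v = tabulate λ w → does (v ~? w)

  degree : Fin n → ℕ
  degree v = ∣ neighbours v ∣

  -- In each maximum the base value 0 is a lower bound of the listed values, so
  -- it matters only for the graph without vertices.

  Δ : ℕ
  Δ = Extremaℕ.max 0 (map degree (allFin n))

  IsClique : Subset n → Set
  IsClique S = ∀ u v → u ∈ S → v ∈ S → u ≢ v → u ~ v

  isClique? : ∀ S → Dec (IsClique S)
  isClique? S = all? λ u → all? λ v →
    (u ∈? S) →-dec ((v ∈? S) →-dec (¬? (u ≟ v) →-dec (u ~? v)))

  ω : ℕ
  ω = Extremaℕ.max 0 (map ∣_∣ (filter isClique? (subsets n)))

  -- Each edge is listed once, with its smaller endpoint first.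

  edges : List (Fin n × Fin n)
  edges = filter (λ (u , v) → (u <? v) ×-dec (u ~? v))
                 (cartesianProduct (allFin n) (allFin n))

  EdgeSet : Set
  EdgeSet = Subset (length edges)

  -- Subgraphs need not be induced.

  IsSubgraph : Subset n → EdgeSet → Set
  IsSubgraph V E = ∀ e → e ∈ E → let (u , v) = lookup edges e in u ∈ V × v ∈ V

  isSubgraph? : ∀ V E → Dec (IsSubgraph V E)
  isSubgraph? V E = all? λ e → (e ∈? E) →-dec
    ((proj₁ (lookup edges e) ∈? V) ×-dec (proj₂ (lookup edges e) ∈? V))

  record NonemptySubgraph : Set where
    constructor subgraph
    field
      V          : Subset n
      E          : EdgeSet
      isSubgraph : IsSubgraph V E
      nonempty   : Nonempty V

  nonemptySubgraphs : List NonemptySubgraph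
  nonemptySubgraphs = mapMaybe
    (λ (V , E) → Maybe.map (λ (s , ne) → subgraph V E s ne)
                           (dec⇒maybe (isSubgraph? V E ×-dec nonempty? V)))
    (cartesianProduct (subsets n) (subsets (length edges)))

  averageDegree : NonemptySubgraph → ℚ
  averageDegree H = (+ (2 ℕ.* ∣ E ∣)) / ∣ V ∣
    where
    open NonemptySubgraph H
    instance
      ∣V∣≢0 : NonZero ∣ V ∣
      ∣V∣≢0 = ∈⇒nonZero (proj₂ nonempty)

  mad : ℚ
  mad = Extremaℚ.max 0ℚ (map averageDegree nonemptySubgraphs)

  Walk : ℕ → Rel (Fin n) 0ℓ
  Walk zero    u v = u ≡ v
  Walk (suc k) u v = ∃ λ w → u ~ w × Walk k w v

  walk? : ∀ k → Decidable (Walk k)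
  walk? zero    u v = u ≟ v
  walk? (suc k) u v = any? λ w → (u ~? w) ×-dec walk? k w v

  Distance : ℕ → Rel (Fin n) 0ℓ
  Distance k u v = Walk k u v × (∀ {j} → j ℕ.< k → ¬ Walk j u v)

  distance? : ∀ k → Decidable (Distance k)
  distance? k u v = walk? k u v ×-dec ℕ.allUpTo? (λ j → ¬? (walk? j u v)) k

  private
    snoc : ∀ k {u v w} → Walk k u v → v ~ w → Walk (suc k) u w
    snoc zero    refl        v~w = _ , v~w , refl
    snoc (suc k) (x , e , p) v~w = x , e , snoc k p v~w

    reverse : ∀ k → Symmetric (Walk k)
    reverse zero    refl        = refl
    reverse (suc k) (w , e , p) = snoc k (reverse k p) (~-sym e)

  Distance-sym : ∀ k → Symmetric (Distance k)
  Distance-sym k (p , min) = reverse k p , λ j<k q → min j<k (reverse _ q)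

  infix 9 _²
  _² : Graph n
  _² = record
    { _~_      = λ u v → u ~ v ⊎ Distance 2 u v
    ; _~?_     = λ u v → (u ~? v) ⊎-dec distance? 2 u v
    ; ~-sym    = λ { (inj₁ e) → inj₁ (~-sym e) ; (inj₂ d) → inj₂ (Distance-sym 2 d) }
    ; ~-irrefl = λ { u≡v (inj₁ e)         → ~-irrefl u≡v e
                   ; u≡v (inj₂ (_ , min)) → min (ℕ.s≤s ℕ.z≤n) u≡v }
    }

{-# OPTIONS --safe #-}

-- Since mad(G) < 4, the edges can be oriented so that every vertex has at most two out-neighbours.
-- Two members of a clique S of G² then have a common out-neighbour, or a common in-neighbour (at most
-- D times for a given member), or one reaches the other in at most two steps. The last happens at
-- most 7|S| times in total, so all but |S|/20 members are good, meaning reached at most 140 times.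
-- Let d(a), m(a,b) count the members of S with out-neighbour a, respectively a and b. A good member
-- with out-neighbours a, b gives |S| + m(a,b) ≤ d(a) + d(b) + D + 147. Let K be the set of
-- out-neighbours of good members. All but 46 members of S have both out-neighbours in K, as the
-- others miss too many good members. If |K| ≤ 5, then 2|S| ≤ 5D + 92 because d ≤ D. If |K| ≥ 6, sum
-- the displayed inequality over the partners b of a vertex a of K with d(a) minimum; together with
-- Σ d ≤ 2|S| over K this again bounds |S|, extremally when |K| = 6 and all vertices of K are partners.
module Submission where

open import Defs
open import Data.Bool.Base using (Bool; true; false; not; _∧_; T; if_then_else_)
open import Data.Bool.Properties using (∧-conicalˡ; ∧-conicalʳ; T-≡; ∧-zeroʳ; ∧-identityʳ)
  renaming (_≟_ to _≟ᵇ_)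
open import Data.Empty using (⊥; ⊥-elim)
open import Data.Fin.Base using (Fin; zero; suc) renaming (_<_ to _<ᶠ_)
open import Data.Fin.Properties as Fin using (_≟_; any?; suc-injective)
open import Data.Nat.Base as ℕ
  using (ℕ; zero; suc; NonZero; z≤n; s≤s; s≤s⁻¹; _+_; _*_; _∸_; _≤_; _<_; _≤ᵇ_)
import Data.Nat.Properties as ℕ
open import Data.Nat.Tactic.RingSolver using (solve-∀)
open import Algebra.Properties.Semiring.Sum ℕ.+-*-semiring
  using (sum; sum-cong-≗; ∑-distrib-+; ∑-comm; *-distribˡ-sum; *-distribʳ-sum; sum-replicate-zero)
open import Data.Product.Base using (_×_; _,_; ∃; proj₁; proj₂)
open import Data.Sum.Base using (_⊎_; inj₁; inj₂)
open import Function.Base using (_∘_; case_of_; id)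
open import Function.Bundles using (Equivalence)
open import Relation.Binary.PropositionalEquality
  using (_≡_; _≢_; refl; sym; trans; cong; cong₂; subst; module ≡-Reasoning)
open import Relation.Nullary.Decidable
  using (Dec; yes; no; does; dec-true; dec-false; _×-dec_; ¬?; dec⇒maybe)
open import Relation.Nullary.Negation using (contradiction)
open import Data.Fin.Subset using (Subset; inside; ∣_∣; Nonempty) renaming (_∈_ to _∈ˢ_)
open import Data.Fin.Subset.Properties using (nonempty?)
import Data.Integer.Base as ℤ
import Data.Integer.Properties as ℤ
open import Data.List.Base as List using (allFin; cartesianProduct; length; lookup)
open import Data.List.Membership.Propositional using (_∈_; lose)
open import Data.List.Membership.Propositional.Properties
  using (∈-map⁺; ∈-++⁺ˡ; ∈-++⁺ʳ; ∈-cartesianProduct⁺; ∈-filter⁺; ∈-filter⁻; ∈-lookup; ∈-allFin)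
open import Data.List.Extrema.Nat using (argmax-all; v≤max⁺)
import Data.List.Relation.Unary.All as All
import Data.List.Relation.Unary.All.Properties as All
open import Data.List.Relation.Unary.Any using (here; index)
import Data.List.Relation.Unary.Any.Properties as Any
import Data.Maybe.Base as Maybe
open import Data.Maybe.Relation.Unary.Any using (just) renaming (Any to MaybeAny)
open import Data.Rational.Base as ℚ using (_/_; toℚᵘ)
import Data.Rational.Properties as ℚ
open import Data.Rational.Unnormalised.Base as ℚᵘ using (mkℚᵘ; *<*; *≤*)
import Data.Rational.Unnormalised.Properties as ℚᵘ
open import Data.Vec.Base as Vec using (tabulate)
open import Data.Vec.Properties using (lookup∘tabulate; lookup⇒[]=; []=⇒lookup)
open import Relation.Binary.Definitions using (tri<; tri≈; tri>)

-- Finite sums and counting with Boolean predicates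

true⇒ : ∀ {P : Set} (P? : Dec P) → does P? ≡ true → P
true⇒ (yes p) refl = p

𝟙 : Bool → ℕ
𝟙 false = 0
𝟙 true  = 1

𝟙≤1 : ∀ b → 𝟙 b ≤ 1
𝟙≤1 false = z≤n
𝟙≤1 true  = ℕ.≤-refl

𝟙* : ∀ b k → 𝟙 b * k ≤ k
𝟙* false k = z≤n
𝟙* true  k = ℕ.≤-reflexive (ℕ.+-identityʳ k)

-- Farkas-style: a ≤ b is a positive combination of hypotheses, and a ≡ suc k + b a semiring identity.
refute : ∀ {a b} k → a ≤ b → a ≡ suc k + b → ⊥
refute {b = b} k a≤b eq = ℕ.m+1+n≰m b {k} (subst (_≤ b) (trans eq (ℕ.+-comm (suc k) b)) a≤b)

sum-mono : ∀ {n} {f g : Fin n → ℕ} → (∀ i → f i ≤ g i) → sum f ≤ sum g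
sum-mono {zero}  f≤g = z≤n
sum-mono {suc n} f≤g = ℕ.+-mono-≤ (f≤g zero) (sum-mono (f≤g ∘ suc))

term≤sum : ∀ {n} (f : Fin n → ℕ) i → f i ≤ sum f
term≤sum f zero    = ℕ.m≤m+n _ _
term≤sum f (suc i) = ℕ.≤-trans (term≤sum (f ∘ suc) i) (ℕ.m≤n+m _ _)

-- The double-counting step: weighted pairs are summed by rows or by columns.
sum-swap-* : ∀ {m n} (f : Fin m → ℕ) (g : Fin m → Fin n → ℕ) →
  sum (λ i → f i * sum (g i)) ≡ sum (λ j → sum (λ i → f i * g i j))
sum-swap-* f g = trans (sum-cong-≗ (λ i → *-distribˡ-sum (f i) (g i))) (∑-comm (λ i j → f i * g i j))

# : ∀ {n} → (Fin n → Bool) → ℕ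
# f = sum (𝟙 ∘ f)

_∖_ : ∀ {n} → (Fin n → Bool) → Fin n → Fin n → Bool
(f ∖ a) i = f i ∧ not (does (i ≟ a))

∖-intro : ∀ {n} (f : Fin n → Bool) {a b} → f b ≡ true → b ≢ a → (f ∖ a) b ≡ true
∖-intro f {a} {b} fb b≢a rewrite fb | dec-false (b ≟ a) b≢a = refl

∖-elim : ∀ {n} (f : Fin n → Bool) {a b} → (f ∖ a) b ≡ true → f b ≡ true × b ≢ a
∖-elim f {a} {b} h with f b | b ≟ a
... | true | no b≢a = refl , b≢a

sum-single : ∀ {n} (f : Fin n → ℕ) a → (∀ i → i ≢ a → f i ≡ 0) → sum f ≡ f a
sum-single {suc n} f zero    f≡0 = trans
  (cong (f zero +_) (trans (sum-cong-≗ {y = λ _ → 0} λ i → f≡0 (suc i) λ ()) (sum-replicate-zero n)))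
  (ℕ.+-identityʳ (f zero))
sum-single {suc n} f (suc a) f≡0 = cong₂ _+_ (f≡0 zero λ ())
  (sum-single (f ∘ suc) a λ i i≢a → f≡0 (suc i) (i≢a ∘ suc-injective))

#-∖ : ∀ {n} (f : Fin n → Bool) a → # f ≡ 𝟙 (f a) + # (f ∖ a)
#-∖ f a = trans (sum-cong-≗ split) (trans (∑-distrib-+ at off) (cong (_+ # (f ∖ a))
  (trans (sum-single at a at≡0) at≡f)))
  where
  at off : _ → ℕ
  at  i = 𝟙 (f i ∧ does (i ≟ a))
  off i = 𝟙 ((f ∖ a) i)
  split : ∀ i → 𝟙 (f i) ≡ at i + off i
  split i with f i | does (i ≟ a)
  ... | false | _     = refl
  ... | true  | false = refl
  ... | true  | true  = refl
  at≡0 : ∀ i → i ≢ a → at i ≡ 0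
  at≡0 i i≢a rewrite dec-false (i ≟ a) i≢a with f i
  ... | false = refl
  ... | true  = refl
  at≡f : at a ≡ 𝟙 (f a)
  at≡f rewrite dec-true (a ≟ a) refl with f a
  ... | false = refl
  ... | true  = refl

#-∖-true : ∀ {n} (f : Fin n → Bool) a → f a ≡ true → # f ≡ suc (# (f ∖ a))
#-∖-true f a fa = trans (#-∖ f a) (cong (λ b → 𝟙 b + # (f ∖ a)) fa)

#≥1 : ∀ {n} (f : Fin n → Bool) {a} → f a ≡ true → 1 ≤ # f
#≥1 f fa = subst (1 ≤_) (sym (#-∖-true f _ fa)) (s≤s z≤n)

#≥2 : ∀ {n} (f : Fin n → Bool) {a b} → f a ≡ true → f b ≡ true → b ≢ a → 2 ≤ # f
#≥2 f {a} fa fb b≢a =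
  subst (2 ≤_) (sym (#-∖-true f _ fa)) (s≤s (#≥1 (f ∖ a) (∖-intro f fb b≢a)))

#≥3 : ∀ {n} (f : Fin n → Bool) {a b c} → f a ≡ true → f b ≡ true → f c ≡ true →
      b ≢ a → c ≢ a → c ≢ b → 3 ≤ # f
#≥3 f {a} fa fb fc b≢a c≢a c≢b = subst (3 ≤_) (sym (#-∖-true f _ fa))
  (s≤s (#≥2 (f ∖ a) (∖-intro f fb b≢a) (∖-intro f fc c≢a) c≢b))

#≥1⇒∃ : ∀ {n} (f : Fin n → Bool) → 1 ≤ # f → ∃ λ a → f a ≡ true
#≥1⇒∃ {suc n} f 1≤ with f zero in eq
... | true  = zero , eq
... | false = let a , fa = #≥1⇒∃ (f ∘ suc) 1≤ in suc a , fa

#≥2⇒∃₂ : ∀ {n} (f : Fin n → Bool) → 2 ≤ # f → ∃ λ a → ∃ λ b → f a ≡ true × f b ≡ true × b ≢ a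
#≥2⇒∃₂ f 2≤ =
  let a , fa   = #≥1⇒∃ f (ℕ.≤-trans (s≤s z≤n) 2≤)
      b , fb∖a = #≥1⇒∃ (f ∖ a) (s≤s⁻¹ (subst (2 ≤_) (#-∖-true f a fa) 2≤))
      fb , b≢a = ∖-elim f fb∖a
  in a , b , fa , fb , b≢a

#≥2⇒∃≢ : ∀ {n} (f : Fin n → Bool) e → 2 ≤ # f → ∃ λ b → f b ≡ true × b ≢ e
#≥2⇒∃≢ f e 2≤ with #≥2⇒∃₂ f 2≤
... | a , b , fa , fb , b≢a with a ≟ e
...   | yes refl = b , fb , b≢a
...   | no  a≢e  = a , fa , a≢e

#≤1⇒subsingleton : ∀ {n} (f : Fin n → Bool) {a b} → # f ≤ 1 → f a ≡ true → f b ≡ true → b ≡ a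
#≤1⇒subsingleton f {a} {b} #f≤1 fa fb with b ≟ a
... | yes b≡a = b≡a
... | no  b≢a = contradiction (#≥2 f fa fb b≢a) (ℕ.<⇒≱ (s≤s #f≤1))

-- Descent: `k` bounds the value at the current candidate, and every smaller value found lowers that
-- bound.
minimise : ∀ {n} (f : Fin n → Bool) (h : Fin n → ℕ) → (∃ λ a → f a ≡ true) →
  ∃ λ e → f e ≡ true × (∀ b → f b ≡ true → h e ≤ h b)
minimise {n} f h (a , fa) = go (h a) a fa ℕ.≤-refl
  where
  go : ∀ k a → f a ≡ true → h a ≤ k → ∃ λ e → f e ≡ true × (∀ b → f b ≡ true → h e ≤ h b)
  go k a fa ha≤k with any? (λ b → (f b ≟ᵇ true) ×-dec (h b ℕ.<? h a))
  ... | no none = a , fa , λ b fb → ℕ.≮⇒≥ λ hb<ha → none (b , fb , hb<ha)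
  go zero    a fa ha≤k | yes (b , fb , hb<ha) = contradiction (ℕ.<-≤-trans hb<ha ha≤k) λ ()
  go (suc k) a fa ha≤k | yes (b , fb , hb<ha) = go k b fb (s≤s⁻¹ (ℕ.<-≤-trans hb<ha ha≤k))

T⇒true : ∀ {b} → T b → b ≡ true
T⇒true = Equivalence.to T-≡

-- Linear arithmetic

+≤+ : ∀ {a b c d} → a ≤ b → c ≤ d → a + c ≤ b + d
+≤+ = ℕ.+-mono-≤

×≤ : ∀ {a b} k → a ≤ b → k * a ≤ k * b
×≤ k = ℕ.*-monoʳ-≤ k

-- Substituting `b ≤ s/20` and `D ≤ 2s/5 - 213` leaves `i ≥ 3s/20 + 419`.
poor-arith : ∀ s D b i → 5 * D + 1065 ≤ 2 * s → 20 * b ≤ s →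
             s ≤ b + D + (D + (7 + i)) → 3 * s + 8380 ≤ 20 * i
poor-arith s D b i large few h = ℕ.≮⇒≥ λ lt →
  refute 0 (+≤+ (×≤ 20 h) (+≤+ few (+≤+ (×≤ 8 large) lt))) (eq s D b i)
  where
  eq : ∀ s D b i → 20 * s + (20 * b + (8 * (5 * D + 1065) + suc (20 * i)))
     ≡ 1 + (20 * (b + D + (D + (7 + i))) + (s + (8 * (2 * s) + (3 * s + 8380))))
  eq = solve-∀

few-poor-arith : ∀ s p i → p * (3 * s + 8380) ≤ 20 * i → i ≤ s * 7 → p ≤ 46
few-poor-arith s p i total i≤ = ℕ.≮⇒≥ λ 47≤p → refute (s + 393859)
  (+≤+ (ℕ.*-monoˡ-≤ (3 * s + 8380) 47≤p) (+≤+ total (×≤ 20 i≤))) (eq s (p * (3 * s + 8380)) i)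
  where
  eq : ∀ s t i → 47 * (3 * s + 8380) + (t + 20 * i) ≡ suc (s + 393859) + (t + (20 * i + 20 * (s * 7)))
  eq = solve-∀

rich-arith : ∀ s i → 3 * s + 8380 ≤ 20 * i → i ≤ 140 → ⊥
rich-arith s i h i≤140 = refute (3 * s + 5579) (+≤+ h (×≤ 20 i≤140)) (eq s i)
  where
  eq : ∀ s i → 3 * s + 8380 + 20 * i ≡ suc (3 * s + 5579) + (20 * i + 20 * 140)
  eq = solve-∀

core-size-arith : ∀ s D k p t → 5 * D + 1065 ≤ 2 * s → p ≤ 46 → k ≤ 5 →
                  2 * s ≤ t + 2 * p → t ≤ k * D → ⊥
core-size-arith s D k p t large p≤46 k≤5 s≤ t≤ = refute 972
  (+≤+ s≤ (+≤+ t≤ (+≤+ (ℕ.*-monoˡ-≤ D k≤5) (+≤+ (×≤ 2 p≤46) large)))) (eq s D t (k * D) p)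
  where
  eq : ∀ s D t c p → 2 * s + (t + (c + (2 * p + (5 * D + 1065))))
                   ≡ suc 972 + (t + 2 * p + (c + (5 * D + (2 * 46 + 2 * s))))
  eq = solve-∀

-- In units of s / 5 and up to small errors, the hypotheses give D < 2, x ≤ 10 / (r + c) and
-- 3r − (r − 1)x ≤ Q with both Q ≤ 2r and Q ≤ 10 − cx. Only r = 5, c = 1 survives; there every
-- inequality is tight, so the error term b has to be replaced by the constant bound on w.
core-arith : ∀ s D b w x r c M Q → 5 * D + 1065 ≤ 2 * s → 20 * b ≤ s → w ≤ 46 →
  1 ≤ r → 1 ≤ c → 6 ≤ r + c →
  r * s + M ≤ r * (x + (D + 147)) + Q →
  x ≤ M + b → (c ≡ 1 → x ≤ M + w) →
  Q ≤ r * D → Q + c * x ≤ 2 * s → (r + c) * x ≤ 2 * s → ⊥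
core-arith s D b w x r c M Q large few w≤ = go r c
  where
  x≤ : ∀ k m → k ≤ m → m * x ≤ 2 * s → k * x ≤ 2 * s
  x≤ k m k≤m = ℕ.≤-trans (ℕ.*-monoˡ-≤ x k≤m)
  Qx≤ : ∀ k m → k ≤ m → Q + m * x ≤ 2 * s → Q + k * x ≤ 2 * s
  Qx≤ k m k≤m = ℕ.≤-trans (ℕ.+-monoʳ-≤ Q (ℕ.*-monoˡ-≤ x k≤m))
  -- Covers `r ≥ 5` with `r + c ≥ 7`, where `r = 5 + j`. By `below`, each of the `j` further terms
  -- `s` on the left is at least its counterpart on the right, so the multipliers for `j = 0`
  -- suffice.
  many : ∀ j → 7 * x ≤ 2 * s → (5 + j) * s + M ≤ (5 + j) * (x + (D + 147)) + Q →
         x ≤ M + b → Q + 1 * x ≤ 2 * s → ⊥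
  many j 7x≤ A0 A1 A3 = refute (13 * s + 46199)
    (+≤+ (×≤ 140 (+≤+ A0 (+≤+ A1 A3))) (+≤+ (×≤ 7 few) (+≤+ (×≤ 60 7x≤)
      (+≤+ (×≤ 140 large) (×≤ 140 (×≤ j below)))))) (eq s D b x M Q j)
    where
    eq₀ : ∀ s D x → 35 * suc s + (5 * (7 * x) + 7 * (5 * D + 1065))
        ≡ suc (11 * s + 2344) + (35 * (x + (D + 147)) + (5 * (2 * s) + 7 * (2 * s)))
    eq₀ = solve-∀
    below : x + (D + 147) ≤ s
    below = ℕ.≮⇒≥ λ lt →
      refute (11 * s + 2344) (+≤+ (×≤ 35 lt) (+≤+ (×≤ 5 7x≤) (×≤ 7 large))) (eq₀ s D x)
    eq : ∀ s D b x M Q j →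
      140 * ((5 + j) * s + M + (x + (Q + 1 * x))) + (7 * (20 * b) + (60 * (7 * x)
        + (140 * (5 * D + 1065) + 140 * (j * (x + (D + 147))))))
      ≡ suc (13 * s + 46199) + (140 * ((5 + j) * (x + (D + 147)) + Q + (M + b + 2 * s)) + (7 * s
        + (60 * (2 * s) + (140 * (2 * s) + 140 * (j * s)))))
    eq = solve-∀
  -- For `2 ≤ r ≤ 4` the bounds in `c` are weakened to the least value `c = 6 - r`, which makes
  -- fixed multipliers possible. The cases with `r ≥ 5` and `r + c ≥ 7` go to `many`.
  go : ∀ r c → 1 ≤ r → 1 ≤ c → 6 ≤ r + c →
    r * s + M ≤ r * (x + (D + 147)) + Q →
    x ≤ M + b → (c ≡ 1 → x ≤ M + w) →
    Q ≤ r * D → Q + c * x ≤ 2 * s → (r + c) * x ≤ 2 * s → ⊥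
  go 1 c _ _ _ A0 A1 _ A2 _ _ = refute (3 * s + 5579)
    (+≤+ (×≤ 20 (+≤+ A0 (+≤+ A1 A2))) (+≤+ few (×≤ 8 large))) (eq s D b x M Q)
    where
    eq : ∀ s D b x M Q →
      20 * (1 * s + M + (x + Q)) + (20 * b + 8 * (5 * D + 1065))
      ≡ suc (3 * s + 5579) + (20 * (1 * (x + (D + 147)) + Q + (M + b + 1 * D)) + (s + 8 * (2 * s)))
    eq = solve-∀
  go 2 c _ _ 6≤ A0 A1 _ A2 _ A4 = refute (s + 33479)
    (+≤+ (×≤ 60 (+≤+ A0 (+≤+ A1 A2))) (+≤+ (×≤ 3 few) (+≤+ (×≤ 10 (x≤ 6 (2 + c) 6≤ A4)) (×≤ 48 large))))
    (eq s D b x M Q)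
    where
    eq : ∀ s D b x M Q →
      60 * (2 * s + M + (x + Q)) + (3 * (20 * b) + (10 * (6 * x) + 48 * (5 * D + 1065)))
      ≡ suc (s + 33479) + (60 * (2 * (x + (D + 147)) + Q + (M + b + 2 * D))
        + (3 * s + (10 * (2 * s) + 48 * (2 * s))))
    eq = solve-∀
  go 3 c _ _ 6≤ A0 A1 _ A2 A3 _ = refute (s + 24659)
    (+≤+ (×≤ 20 (+≤+ A0 (+≤+ A1 A2))) (+≤+ (×≤ 40 (+≤+ A0 (+≤+ A1 (Qx≤ 3 c (s≤s⁻¹ (s≤s⁻¹ (s≤s⁻¹ 6≤))) A3))))
      (+≤+ (×≤ 3 few) (×≤ 48 large)))) (eq s D b x M Q)
    where
    eq : ∀ s D b x M Q →
      20 * (3 * s + M + (x + Q)) + (40 * (3 * s + M + (x + (Q + 3 * x)))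
        + (3 * (20 * b) + 48 * (5 * D + 1065)))
      ≡ suc (s + 24659) + (20 * (3 * (x + (D + 147)) + Q + (M + b + 3 * D))
        + (40 * (3 * (x + (D + 147)) + Q + (M + b + 2 * s)) + (3 * s + 48 * (2 * s))))
    eq = solve-∀
  go 4 c _ _ 6≤ A0 A1 _ _ A3 A4 = refute (s + 15839)
    (+≤+ (×≤ 60 (+≤+ A0 (+≤+ A1 (Qx≤ 2 c (s≤s⁻¹ (s≤s⁻¹ (s≤s⁻¹ (s≤s⁻¹ 6≤)))) A3))))
      (+≤+ (×≤ 3 few) (+≤+ (×≤ 10 (x≤ 6 (4 + c) 6≤ A4)) (×≤ 48 large)))) (eq s D b x M Q)
    where
    eq : ∀ s D b x M Q →
      60 * (4 * s + M + (x + (Q + 2 * x))) + (3 * (20 * b) + (10 * (6 * x) + 48 * (5 * D + 1065)))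
      ≡ suc (s + 15839) + (60 * (4 * (x + (D + 147)) + Q + (M + b + 2 * s))
        + (3 * s + (10 * (2 * s) + 48 * (2 * s))))
    eq = solve-∀
  -- All variables cancel, and the contradiction is the constant 568 = 2 · 1065 - 10 · 147 - 2 · 46.
  go 5 1 _ _ 6≤ A0 _ A1 _ A3 A4 = refute 567
    (+≤+ (×≤ 2 (+≤+ A0 (+≤+ (A1 refl) A3))) (+≤+ A4 (+≤+ (×≤ 2 w≤) (×≤ 2 large)))) (eq s D w x M Q)
    where
    eq : ∀ s D w x M Q →
      2 * (5 * s + M + (x + (Q + 1 * x))) + (6 * x + (2 * w + 2 * (5 * D + 1065)))
      ≡ suc 567 + (2 * (5 * (x + (D + 147)) + Q + (M + w + 2 * s)) + (2 * s + (2 * 46 + 2 * (2 * s))))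
    eq = solve-∀
  go 5 (suc (suc c)) _ _ _ A0 A1 _ _ A3 A4 =
    many 0 (x≤ 7 (7 + c) (ℕ.+-monoʳ-≤ 5 (s≤s (s≤s z≤n))) A4) A0 A1 (Qx≤ 1 (2 + c) (s≤s z≤n) A3)
  go (suc (suc (suc (suc (suc (suc r)))))) c _ 1≤c _ A0 A1 _ _ A3 A4 =
    many (suc r) (x≤ 7 (6 + r + c) (ℕ.+-mono-≤ {6} (ℕ.m≤m+n 6 r) 1≤c) A4) A0 A1 (Qx≤ 1 c 1≤c A3)

-- Counting in an oriented square clique

sum-*-bound : ∀ {n} (f g : Fin n → ℕ) k → (∀ i → g i ≤ k) → sum (λ i → f i * g i) ≤ sum f * k
sum-*-bound f g k g≤k = ℕ.≤-trans (sum-mono λ i → ℕ.*-monoʳ-≤ (f i) (g≤k i))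
                                  (ℕ.≤-reflexive (sym (*-distribʳ-sum k f)))

-- One constructor for each orientation of an edge, or of a path with two edges, between `x` and
-- `y`.
data Link {n} (o : Fin n → Fin n → Bool) (x y : Fin n) : Set where
  arc      : o x y ≡ true → Link o x y
  arc⁻     : o y x ≡ true → Link o x y
  path     : ∀ z → o x z ≡ true → o z y ≡ true → Link o x y
  path⁻    : ∀ z → o y z ≡ true → o z x ≡ true → Link o x y
  shareOut : ∀ z → o x z ≡ true → o y z ≡ true → Link o x y
  shareIn  : ∀ z → o z x ≡ true → o z y ≡ true → Link o x y

module Reach {n} (o : Fin n → Fin n → Bool) where

  -- Counted with multiplicity; commonIn omits y = x, which would add another indegree to its sum.
  reach commonIn : Fin n → Fin n → ℕ
  reach    x y = 𝟙 (does (x ≟ y)) + (𝟙 (o x y) + sum λ z → 𝟙 (o x z) * 𝟙 (o z y))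
  commonIn x y = sum λ z → 𝟙 (o z x) * 𝟙 ((o z ∖ x) y)

  reach-refl : ∀ x → 1 ≤ reach x x
  reach-refl x rewrite dec-true (x ≟ x) refl = s≤s z≤n

  reach-arc : ∀ x y → o x y ≡ true → 1 ≤ reach x y
  reach-arc x y xy rewrite xy = ℕ.≤-trans (s≤s z≤n) (ℕ.m≤n+m _ (𝟙 (does (x ≟ y))))

  reach-path : ∀ x y z → o x z ≡ true → o z y ≡ true → 1 ≤ reach x y
  reach-path x y z xz zy = ℕ.≤-trans 1≤ (ℕ.≤-trans
    (ℕ.≤-trans (term≤sum (λ z → 𝟙 (o x z) * 𝟙 (o z y)) z) (ℕ.m≤n+m _ (𝟙 (o x y))))
    (ℕ.m≤n+m _ (𝟙 (does (x ≟ y)))))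
    where
    1≤ : 1 ≤ 𝟙 (o x z) * 𝟙 (o z y)
    1≤ rewrite xz | zy = ℕ.≤-refl

  commonIn-∃ : ∀ x y z → x ≢ y → o z x ≡ true → o z y ≡ true → 1 ≤ commonIn x y
  commonIn-∃ x y z x≢y zx zy =
    ℕ.≤-trans 1≤ (term≤sum (λ z → 𝟙 (o z x) * 𝟙 ((o z ∖ x) y)) z)
    where
    1≤ : 1 ≤ 𝟙 (o z x) * 𝟙 ((o z ∖ x) y)
    1≤ rewrite zx | ∖-intro (o z) zy (x≢y ∘ sym) = ℕ.≤-refl

  module _ (out≤2 : ∀ x → # (o x) ≤ 2) where

    -- At most 1, 2 and 4 directed walks of length 0, 1 and 2 start at `x`.
    sum-reach : ∀ x → sum (reach x) ≤ 7
    sum-reach x = begin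
      sum (reach x)                  ≡⟨ ∑-distrib-+ eq (λ y → arc₁ y + arc₂ y) ⟩
      sum eq + sum (λ y → arc₁ y + arc₂ y) ≡⟨ cong (sum eq +_) (∑-distrib-+ arc₁ arc₂) ⟩
      sum eq + (# (o x) + sum arc₂)  ≤⟨ ℕ.+-mono-≤ eq≤1 (ℕ.+-mono-≤ (out≤2 x) arc₂≤4) ⟩
      7                              ∎
      where
      open ℕ.≤-Reasoning
      eq arc₁ arc₂ : Fin n → ℕ
      eq   y = 𝟙 (does (x ≟ y))
      arc₁ y = 𝟙 (o x y)
      arc₂ y = sum λ z → 𝟙 (o x z) * 𝟙 (o z y)
      eq≤1 : sum eq ≤ 1
      eq≤1 = ℕ.≤-trans (ℕ.≤-reflexive
        (sum-single eq x λ y y≢x → cong 𝟙 (dec-false (x ≟ y) (y≢x ∘ sym)))) (𝟙≤1 _)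
      arc₂≤4 : sum arc₂ ≤ 4
      arc₂≤4 = begin
        sum arc₂                          ≡⟨ sum-swap-* (𝟙 ∘ o x) (λ z y → 𝟙 (o z y)) ⟨
        sum (λ z → 𝟙 (o x z) * # (o z))   ≤⟨ sum-*-bound (𝟙 ∘ o x) (# ∘ o) 2 out≤2 ⟩
        # (o x) * 2                       ≤⟨ ℕ.*-monoˡ-≤ 2 (out≤2 x) ⟩
        4                                 ∎

    -- Each `z` with an arc to `x` has at most one further out-neighbour, so it is charged at most
    -- once.
    sum-commonIn : ∀ x → sum (commonIn x) ≤ # (λ z → o z x)
    sum-commonIn x = ℕ.≤-trans
      (ℕ.≤-reflexive (sym (sum-swap-* (λ z → 𝟙 (o z x)) (λ z y → 𝟙 ((o z ∖ x) y)))))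
      (sum-mono bound)
      where
      bound : ∀ z → 𝟙 (o z x) * # (o z ∖ x) ≤ 𝟙 (o z x)
      bound z with o z x in zx
      ... | false = z≤n
      ... | true  = ℕ.≤-trans (ℕ.≤-reflexive (ℕ.+-identityʳ _))
                              (s≤s⁻¹ (subst (_≤ 2) (#-∖-true (o z) x zx) (out≤2 z)))

module Counting {n} (o : Fin n → Fin n → Bool) (S : Fin n → Bool) (D : ℕ)
  (out≤2  : ∀ x → # (o x) ≤ 2)
  (in≤D   : ∀ a → # (λ x → o x a) ≤ D)
  (linked : ∀ x y → S x ≡ true → S y ≡ true → x ≢ y → Link o x y)
  where

  open Reach o

  sumS : (Fin n → ℕ) → ℕ
  sumS w = sum λ y → 𝟙 (S y) * w y

  inReach : Fin n → ℕ
  inReach x = sumS λ y → reach y x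

  rest : Fin n → Fin n → ℕ
  rest x y = commonIn x y + (reach x y + reach y x)

  -- Every link other than a shared out-neighbour is counted in `rest`. The case `y = x` is no
  -- exception, because the trivial walk makes `reach x x` positive.
  cover : ∀ x y → S x ≡ true → S y ≡ true →
          (∃ λ z → o x z ≡ true × o y z ≡ true) ⊎ 1 ≤ rest x y
  cover x y Sx Sy = split (x ≟ y)
    where
    forth : 1 ≤ reach x y → 1 ≤ rest x y
    forth 1≤ = ℕ.≤-trans 1≤ (ℕ.≤-trans (ℕ.m≤m+n _ _) (ℕ.m≤n+m _ (commonIn x y)))
    back : 1 ≤ reach y x → 1 ≤ rest x y
    back 1≤ = ℕ.≤-trans 1≤ (ℕ.≤-trans (ℕ.m≤n+m _ (reach x y)) (ℕ.m≤n+m _ (commonIn x y)))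
    split : Dec (x ≡ y) → (∃ λ z → o x z ≡ true × o y z ≡ true) ⊎ 1 ≤ rest x y
    split (yes refl) = inj₂ (forth (reach-refl x))
    split (no x≢y) with linked x y Sx Sy x≢y
    ... | arc xy           = inj₂ (forth (reach-arc x y xy))
    ... | arc⁻ yx          = inj₂ (back (reach-arc y x yx))
    ... | path z xz zy     = inj₂ (forth (reach-path x y z xz zy))
    ... | path⁻ z yz zx    = inj₂ (back (reach-path y x z yz zx))
    ... | shareOut z xz yz = inj₁ (z , xz , yz)
    ... | shareIn z zx zy  = inj₂ (ℕ.≤-trans (commonIn-∃ x y z x≢y zx zy) (ℕ.m≤m+n _ _))

  -- Sum the hypothesis over `S`: common in-neighbours contribute at most `D`, walks out of `x` at
  -- most 7, and walks into `x` give `inReach x`. The weight `w` pays for shared out-neighbours, and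
  -- `c` records what it pays in excess.
  count : ∀ x (w c : Fin n → ℕ) → (∀ y → S y ≡ true → 1 + c y ≤ w y + rest x y) →
          # S + sumS c ≤ sumS w + (D + (7 + inReach x))
  count x w c h = begin
    # S + sumS c ≡⟨ ∑-distrib-+ (𝟙 ∘ S) (λ y → 𝟙 (S y) * c y) ⟨
    sum (λ y → 𝟙 (S y) + 𝟙 (S y) * c y) ≤⟨ sum-mono pointwise ⟩
    sum (λ y → Sw y + (commonIn x y + (reach x y + SR y)))
      ≡⟨ ∑-distrib-+ Sw (λ y → commonIn x y + (reach x y + SR y)) ⟩
    sumS w + sum (λ y → commonIn x y + (reach x y + SR y))
      ≡⟨ cong (sumS w +_) (∑-distrib-+ (commonIn x) (λ y → reach x y + SR y)) ⟩
    sumS w + (sum (commonIn x) + sum (λ y → reach x y + SR y))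
      ≡⟨ cong (λ t → sumS w + (sum (commonIn x) + t)) (∑-distrib-+ (reach x) SR) ⟩
    sumS w + (sum (commonIn x) + (sum (reach x) + inReach x))
      ≤⟨ ℕ.+-monoʳ-≤ (sumS w) (ℕ.+-mono-≤ (ℕ.≤-trans (sum-commonIn out≤2 x) (in≤D x))
           (ℕ.+-monoˡ-≤ (inReach x) (sum-reach out≤2 x))) ⟩
    sumS w + (D + (7 + inReach x)) ∎
    where
    open ℕ.≤-Reasoning
    Sw SR : Fin n → ℕ
    Sw y = 𝟙 (S y) * w y
    SR y = 𝟙 (S y) * reach y x
    pointwise : ∀ y → 𝟙 (S y) + 𝟙 (S y) * c y ≤ Sw y + (commonIn x y + (reach x y + SR y))
    pointwise y with S y in Sy
    ... | false = z≤n
    ... | true  rewrite ℕ.*-identityˡ (c y) | ℕ.*-identityˡ (w y) | ℕ.*-identityˡ (reach y x) = h y Sy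

  -- Count the walks at their starting points, at most seven for each member.
  sumS-inReach : sumS inReach ≤ # S * 7
  sumS-inReach = begin
    sumS inReach                       ≤⟨ sum-mono (λ x → 𝟙* (S x) (inReach x)) ⟩
    sum inReach                        ≡⟨ sum-swap-* (𝟙 ∘ S) reach ⟨
    sumS (λ y → sum (reach y))         ≤⟨ sum-*-bound (𝟙 ∘ S) _ 7 (sum-reach out≤2) ⟩
    # S * 7                            ∎
    where open ℕ.≤-Reasoning

  good bad : Fin n → Bool
  good x = S x ∧ (inReach x ≤ᵇ 140)
  bad  x = S x ∧ not (inReach x ≤ᵇ 140)

  -- Markov's inequality: a bad member is reached more than 140 = 7 · 20 times, out of at most
  -- `7|S|` in total.
  few-bad : 20 * # bad ≤ # S
  few-bad = ℕ.*-cancelˡ-≤ 7 (begin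
    7 * (20 * # bad)                  ≡⟨ ℕ.*-assoc 7 20 (# bad) ⟨
    140 * # bad                       ≡⟨ *-distribˡ-sum 140 (𝟙 ∘ bad) ⟩
    sum (λ x → 140 * 𝟙 (bad x))       ≤⟨ sum-mono pointwise ⟩
    sumS inReach                      ≤⟨ sumS-inReach ⟩
    # S * 7                           ≡⟨ ℕ.*-comm (# S) 7 ⟩
    7 * # S                           ∎)
    where
    open ℕ.≤-Reasoning
    pointwise : ∀ x → 140 * 𝟙 (bad x) ≤ 𝟙 (S x) * inReach x
    pointwise x with S x | inReach x ≤ᵇ 140 in eq
    ... | false | _     = z≤n
    ... | true  | true  = z≤n
    ... | true  | false = ℕ.≤-trans (ℕ.<⇒≤ (ℕ.≰⇒> λ ≤140 → case trans (sym eq) (T⇒true (ℕ.≤⇒≤ᵇ ≤140)) of λ ()))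
                                    (ℕ.≤-reflexive (sym (ℕ.*-identityˡ _)))

  -- Structure of a clique that exceeds the bound

  module _ (large : 5 * D + 1065 ≤ 2 * # S) where

    -- d, m and K of the introduction are degS, mult and core.
    degS : Fin n → ℕ
    degS a = sumS λ x → 𝟙 (o x a)

    mult : Fin n → Fin n → ℕ
    mult a b = sumS λ x → 𝟙 (o x a) * 𝟙 (o x b)

    degS≤D : ∀ a → degS a ≤ D
    degS≤D a = ℕ.≤-trans (sum-mono λ x → 𝟙* (S x) (𝟙 (o x a))) (in≤D a)

    good⇒S : ∀ x → good x ≡ true → S x ≡ true
    good⇒S x = ∧-conicalˡ (S x) _

    good⇒inReach : ∀ x → good x ≡ true → inReach x ≤ 140
    good⇒inReach x gx = ℕ.≤ᵇ⇒≤ _ _ (Equivalence.from T-≡ (∧-conicalʳ (S x) _ gx))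

    core? : ∀ a → Dec (∃ λ x → good x ≡ true × o x a ≡ true)
    core? a = any? λ x → (good x ≟ᵇ true) ×-dec (o x a ≟ᵇ true)

    core : Fin n → Bool
    core a = does (core? a)

    coreOut : Fin n → Fin n → Bool
    coreOut x a = core a ∧ o x a

    coreOut≤2 : ∀ x → # (coreOut x) ≤ 2
    coreOut≤2 x = ℕ.≤-trans (sum-mono λ a → le (core a) (o x a)) (out≤2 x)
      where
      le : ∀ a b → 𝟙 (a ∧ b) ≤ 𝟙 b
      le false b = z≤n
      le true  b = ℕ.≤-refl

    -- An out-neighbour shared with a good member lies in the core, so with good members a poor `x`
    -- can share only its single core out-neighbour `q`. Hence `S` is covered by the bad members, at
    -- most `D` in-neighbours of `q`, and at most `D + 7 + inReach x` members counted in `rest`.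
    poor⇒inReach : ∀ x → S x ≡ true → # (coreOut x) ≤ 1 → 3 * # S + 8380 ≤ 20 * inReach x
    poor⇒inReach x Sx ≤1 = poor-arith (# S) D (# bad) (inReach x) large few-bad (ℕ.≤-trans
      (ℕ.≤-trans (ℕ.m≤m+n _ _) (count x w (λ _ → 0) covered)) (ℕ.+-monoˡ-≤ _ sumS-w))
      where
      unique : ∃ λ q → ∀ a → coreOut x a ≡ true → a ≡ q
      unique with any? (λ q → coreOut x q ≟ᵇ true)
      ... | yes (q , xq) = q , λ a xa → #≤1⇒subsingleton (coreOut x) ≤1 xq xa
      -- `x` is an arbitrary default: without core out-neighbours the condition on `q` is vacuous.
      ... | no  none     = x , λ a xa → contradiction (a , xa) none
      q : Fin n
      q = proj₁ unique
      w : Fin n → ℕ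
      w y = 𝟙 (not (good y)) + 𝟙 (o y q)
      shared : ∀ y z → good y ≡ true → o x z ≡ true → o y z ≡ true → o y q ≡ true
      shared y z gy xz yz = subst (λ a → o y a ≡ true) (proj₂ unique z out) yz
        where
        out : coreOut x z ≡ true
        out rewrite dec-true (core? z) (y , gy , yz) = xz
      covered : ∀ y → S y ≡ true → 1 + 0 ≤ w y + rest x y
      covered y Sy with good y in gy
      ... | false = s≤s z≤n
      ... | true with cover x y Sx Sy
      ...   | inj₂ 1≤ = ℕ.≤-trans 1≤ (ℕ.m≤n+m _ (𝟙 (o y q)))
      ...   | inj₁ (z , xz , yz) rewrite shared y z gy xz yz = s≤s z≤n
      sumS-w : sumS w ≤ # bad + D
      sumS-w = begin
        sumS w                                  ≤⟨ sum-mono (λ y → le (S y) (inReach y ≤ᵇ 140) (𝟙 (o y q))) ⟩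
        sum (λ y → 𝟙 (bad y) + 𝟙 (S y) * 𝟙 (o y q)) ≡⟨ ∑-distrib-+ (𝟙 ∘ bad) (λ y → 𝟙 (S y) * 𝟙 (o y q)) ⟩
        # bad + degS q                          ≤⟨ ℕ.+-monoʳ-≤ (# bad) (degS≤D q) ⟩
        # bad + D                               ∎
        where
        open ℕ.≤-Reasoning
        le : ∀ b c k → 𝟙 b * (𝟙 (not (b ∧ c)) + k) ≤ 𝟙 (b ∧ not c) + 𝟙 b * k
        le false c k = z≤n
        le true  c k = ℕ.≤-reflexive (trans (ℕ.+-identityʳ _) (cong (𝟙 (not c) +_) (sym (ℕ.+-identityʳ k))))

    poor : Fin n → Bool
    poor x = S x ∧ (# (coreOut x) ≤ᵇ 1)

    -- A poor member is reached at least `(3|S| + 8380)/20` times. The total of `7|S|` allows fewer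
    -- than 47 of them, because 47 · 3 > 7 · 20.
    few-poor : # poor ≤ 46
    few-poor = few-poor-arith (# S) (# poor) (sumS inReach) total sumS-inReach
      where
      open ℕ.≤-Reasoning
      pointwise : ∀ x → 𝟙 (poor x) * (3 * # S + 8380) ≤ 20 * (𝟙 (S x) * inReach x)
      pointwise x with S x in Sx | # (coreOut x) ≤ᵇ 1 in ≤1
      ... | false | _     = z≤n
      ... | true  | false = z≤n
      ... | true  | true  = ℕ.≤-trans (ℕ.≤-reflexive (ℕ.*-identityˡ _)) (ℕ.≤-trans
        (poor⇒inReach x Sx (ℕ.≤ᵇ⇒≤ _ _ (Equivalence.from T-≡ ≤1)))
        (ℕ.≤-reflexive (cong (20 *_) (sym (ℕ.*-identityˡ (inReach x))))))
      total : # poor * (3 * # S + 8380) ≤ 20 * sumS inReach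
      total = begin
        # poor * (3 * # S + 8380)                   ≡⟨ *-distribʳ-sum (3 * # S + 8380) (𝟙 ∘ poor) ⟩
        sum (λ x → 𝟙 (poor x) * (3 * # S + 8380))   ≤⟨ sum-mono pointwise ⟩
        sum (λ x → 20 * (𝟙 (S x) * inReach x))      ≡⟨ *-distribˡ-sum 20 (λ x → 𝟙 (S x) * inReach x) ⟨
        20 * sumS inReach                           ∎

    -- A good member is reached at most 140 times, while having fewer than two core out-neighbours
    -- forces at least 8380/20 = 419.
    good⇒rich : ∀ x → good x ≡ true → 2 ≤ # (coreOut x)
    good⇒rich x gx = ℕ.≰⇒> λ ≤1 →
      rich-arith (# S) (inReach x) (poor⇒inReach x (good⇒S x gx) ≤1) (good⇒inReach x gx)

    -- As `x` has no out-neighbours besides `a` and `b`, the members that share one with it are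
    -- counted by `degS a + degS b`. Those with both are counted twice, and `mult a b` on the left
    -- recovers this surplus. The constant is 7 + 140.
    pair-bound : ∀ x a b → good x ≡ true → o x a ≡ true → o x b ≡ true → b ≢ a →
                 # S + mult a b ≤ degS a + degS b + (D + 147)
    pair-bound x a b gx xa xb b≢a = begin
      # S + mult a b                         ≤⟨ count x w (λ y → 𝟙 (o y a) * 𝟙 (o y b)) covered ⟩
      sumS w + (D + (7 + inReach x))         ≡⟨ cong (_+ (D + (7 + inReach x))) sumS-w ⟩
      degS a + degS b + (D + (7 + inReach x)) ≤⟨ ℕ.+-monoʳ-≤ (degS a + degS b)
                                                   (ℕ.+-monoʳ-≤ D (ℕ.+-monoʳ-≤ 7 (good⇒inReach x gx))) ⟩
      degS a + degS b + (D + 147)            ∎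
      where
      open ℕ.≤-Reasoning
      w : Fin n → ℕ
      w y = 𝟙 (o y a) + 𝟙 (o y b)
      sumS-w : sumS w ≡ degS a + degS b
      sumS-w = trans (sum-cong-≗ λ y → ℕ.*-distribˡ-+ (𝟙 (S y)) (𝟙 (o y a)) (𝟙 (o y b)))
                     (∑-distrib-+ (λ y → 𝟙 (S y) * 𝟙 (o y a)) (λ y → 𝟙 (S y) * 𝟙 (o y b)))
      only : ∀ z → o x z ≡ true → z ≡ a ⊎ z ≡ b
      only z xz with z ≟ a | z ≟ b
      ... | yes z≡a | _       = inj₁ z≡a
      ... | no _    | yes z≡b = inj₂ z≡b
      ... | no z≢a  | no z≢b  = contradiction (#≥3 (o x) xa xb xz b≢a z≢a z≢b) (ℕ.<⇒≱ (s≤s (out≤2 x)))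
      covered : ∀ y → S y ≡ true → 1 + 𝟙 (o y a) * 𝟙 (o y b) ≤ w y + rest x y
      covered y Sy with o y a in ya | o y b in yb
      ... | true  | true  = s≤s (s≤s z≤n)
      ... | true  | false = s≤s z≤n
      ... | false | true  = s≤s z≤n
      ... | false | false with cover x y (good⇒S x gx) Sy
      ...   | inj₂ 1≤ = 1≤
      ...   | inj₁ (z , xz , yz) with only z xz
      ...     | inj₁ refl = case trans (sym ya) yz of λ ()
      ...     | inj₂ refl = case trans (sym yb) yz of λ ()

    sumCore-degS : sum (λ a → 𝟙 (core a) * degS a) ≡ sumS (# ∘ coreOut)
    sumCore-degS = trans (sum-swap-* (𝟙 ∘ core) (λ a x → 𝟙 (S x) * 𝟙 (o x a)))
      (sum-cong-≗ λ x → trans (sum-cong-≗ λ a → regroup (core a) (S x) (o x a))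
                              (sym (*-distribˡ-sum (𝟙 (S x)) (𝟙 ∘ coreOut x))))
      where
      regroup : ∀ c s b → 𝟙 c * (𝟙 s * 𝟙 b) ≡ 𝟙 s * 𝟙 (c ∧ b)
      regroup false false b = refl
      regroup false true  b = refl
      regroup true  false b = refl
      regroup true  true  b = ℕ.+-identityʳ _

    sumCore-degS≤ : sum (λ a → 𝟙 (core a) * degS a) ≤ 2 * # S
    sumCore-degS≤ = begin
      sum (λ a → 𝟙 (core a) * degS a)  ≡⟨ sumCore-degS ⟩
      sumS (# ∘ coreOut)               ≤⟨ sum-*-bound (𝟙 ∘ S) (# ∘ coreOut) 2 coreOut≤2 ⟩
      # S * 2                          ≡⟨ ℕ.*-comm (# S) 2 ⟩
      2 * # S                          ∎
      where open ℕ.≤-Reasoning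

    -- In the count by members, one that is not poor contributes two, and a poor one falls short by
    -- at most two.
    sumCore-degS≥ : 2 * # S ≤ sum (λ a → 𝟙 (core a) * degS a) + 2 * # poor
    sumCore-degS≥ = begin
      2 * # S                                         ≡⟨ *-distribˡ-sum 2 (𝟙 ∘ S) ⟩
      sum (λ x → 2 * 𝟙 (S x))                         ≤⟨ sum-mono pointwise ⟩
      sum (λ x → 𝟙 (S x) * # (coreOut x) + 2 * 𝟙 (poor x))
        ≡⟨ ∑-distrib-+ (λ x → 𝟙 (S x) * # (coreOut x)) (λ x → 2 * 𝟙 (poor x)) ⟩
      sumS (# ∘ coreOut) + sum (λ x → 2 * 𝟙 (poor x))
        ≡⟨ cong₂ _+_ (sym sumCore-degS) (sym (*-distribˡ-sum 2 (𝟙 ∘ poor))) ⟩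
      sum (λ a → 𝟙 (core a) * degS a) + 2 * # poor    ∎
      where
      open ℕ.≤-Reasoning
      rich : ∀ x → (# (coreOut x) ≤ᵇ 1) ≡ false → 2 ≤ # (coreOut x)
      rich x eq = ℕ.≰⇒> λ ≤1 → case trans (sym eq) (T⇒true (ℕ.≤⇒≤ᵇ ≤1)) of λ ()
      pointwise : ∀ x → 2 * 𝟙 (S x) ≤ 𝟙 (S x) * # (coreOut x) + 2 * 𝟙 (poor x)
      pointwise x with S x | # (coreOut x) ≤ᵇ 1 in eq
      ... | false | _     = z≤n
      ... | true  | true  = ℕ.m≤n+m 2 _
      ... | true  | false = ℕ.≤-trans (rich x eq) (ℕ.≤-reflexive
        (sym (trans (ℕ.+-identityʳ _) (ℕ.+-identityʳ _))))

    -- Five core vertices would account for at most `5 D` of the sum, and the poor members for a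
    -- deficit of at most 2 · 46 = 92, well below 1065.
    6≤core : 6 ≤ # core
    6≤core = ℕ.≰⇒> λ ≤5 → core-size-arith (# S) D (# core) (# poor) (sum λ a → 𝟙 (core a) * degS a)
      large few-poor ≤5 sumCore-degS≥
      (sum-*-bound (𝟙 ∘ core) degS D degS≤D)

    -- Counting around a core vertex of least degree

    module _ (e : Fin n) (core-e : core e ≡ true) (e-min : ∀ b → core b ≡ true → degS e ≤ degS b) where
      open ℕ.≤-Reasoning
      -- The partners of `e`, chosen so that `pair-bound` applies to `e` and each of them. The
      -- loners are the rest of the core and include `e` itself.
      mate? : ∀ b → Dec ((∃ λ x → good x ≡ true × o x e ≡ true × o x b ≡ true) × b ≢ e)
      mate? b = (any? λ x → (good x ≟ᵇ true) ×-dec ((o x e ≟ᵇ true) ×-dec (o x b ≟ᵇ true)))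
                ×-dec ¬? (b ≟ e)
      mate loner : Fin n → Bool
      mate  b = does (mate? b)
      loner b = core b ∧ not (mate b)
      M Q : ℕ
      M = sum λ b → 𝟙 (mate b) * mult e b
      Q = sum λ b → 𝟙 (mate b) * degS b

      mate⇒core : ∀ b → mate b ≡ true → core b ≡ true
      mate⇒core b mb = let (x , gx , _ , xb) , _ = true⇒ (mate? b) mb in dec-true (core? b) (x , gx , xb)

      #core : # core ≡ # mate + # loner
      #core = trans (sum-cong-≗ pointwise) (∑-distrib-+ (𝟙 ∘ mate) (𝟙 ∘ loner))
        where
        pointwise : ∀ b → 𝟙 (core b) ≡ 𝟙 (mate b) + 𝟙 (loner b)
        pointwise b with core b in cb | mate b in mb
        ... | true  | true  = refl
        ... | true  | false = refl
        ... | false | false = refl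
        ... | false | true  = case trans (sym cb) (mate⇒core b mb) of λ ()

      loner-e : loner e ≡ true
      loner-e rewrite core-e | dec-false (mate? e) (λ (_ , e≢e) → e≢e refl) = refl

      1≤loner : 1 ≤ # loner
      1≤loner = #≥1 loner loner-e

      rich⇒out : ∀ x → 2 ≤ # (coreOut x) → ∃ λ b → core b ≡ true × o x b ≡ true × b ≢ e
      rich⇒out x 2≤ = let b , xb , b≢e = #≥2⇒∃≢ (coreOut x) e 2≤ in
        b , ∧-conicalˡ (core b) _ xb , ∧-conicalʳ (core b) _ xb , b≢e

      good⇒mate : ∀ x → good x ≡ true → o x e ≡ true → ∃ λ b → mate b ≡ true × o x b ≡ true
      good⇒mate x gx xe = let b , _ , xb , b≢e = rich⇒out x (good⇒rich x gx) in
        b , dec-true (mate? b) ((x , gx , xe , xb) , b≢e) , xb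

      1≤mate : 1 ≤ # mate
      1≤mate = let x , gx , xe = true⇒ (core? e) core-e
                   b , mb , _  = good⇒mate x gx xe
               in #≥1 mate mb

      via-good : ∀ x → S x ≡ true → o x e ≡ true → bad x ≡ false → ∃ λ b → mate b ≡ true × o x b ≡ true
      via-good x Sx xe ¬bad = good⇒mate x (gx Sx ¬bad) xe
        where
        gx : S x ≡ true → bad x ≡ false → good x ≡ true
        gx with S x | inReach x ≤ᵇ 140
        ... | true  | true  = λ _ _ → refl
        ... | true  | false = λ _ ()
        ... | false | _     = λ ()

      outside-loners : # loner ≡ 1 → ∀ b → core b ≡ true → b ≢ e → mate b ≡ true
      outside-loners ≡1 b cb b≢e = by (mate b) refl
        where
        by : ∀ c → mate b ≡ c → mate b ≡ true
        by true  mb = mb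
        by false mb = contradiction
          (#≤1⇒subsingleton loner (ℕ.≤-reflexive ≡1) loner-e (cong₂ (λ c m → c ∧ not m) cb mb)) b≢e

      -- When `e` is the only loner, every other core vertex is a mate, so any second core
      -- out-neighbour will do. The exceptions are then at most 46 poor members instead of up to
      -- `|S|/20` bad ones, as the tight case of `core-arith` requires.
      via-poor : # loner ≡ 1 → ∀ x → S x ≡ true → o x e ≡ true → poor x ≡ false →
                 ∃ λ b → mate b ≡ true × o x b ≡ true
      via-poor ≡1 x Sx xe ¬poor =
        let b , cb , xb , b≢e = rich⇒out x (ℕ.≰⇒> λ ≤1 → case trans (sym ¬poor) (is-poor ≤1) of λ ())
        in b , outside-loners ≡1 b cb b≢e , xb
        where
        is-poor : # (coreOut x) ≤ 1 → poor x ≡ true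
        is-poor ≤1 = cong₂ _∧_ Sx (T⇒true (ℕ.≤⇒≤ᵇ ≤1))

      -- A member counted by `degS e` either has a mate as its other out-neighbour, and is then
      -- counted in `M`, or belongs to the exceptional set `v`, which will be `bad` or `poor`.
      degS-e : ∀ v → (∀ x → S x ≡ true → o x e ≡ true → v x ≡ false →
                      ∃ λ b → mate b ≡ true × o x b ≡ true) →
               degS e ≤ M + # v
      degS-e v h = begin
        degS e                                          ≤⟨ sum-mono pointwise ⟩
        sum (λ x → sum (λ b → t b x) + 𝟙 (v x))         ≡⟨ ∑-distrib-+ (λ x → sum (λ b → t b x)) (𝟙 ∘ v) ⟩
        sum (λ x → sum (λ b → t b x)) + # v
          ≡⟨ cong (_+ # v) (sum-swap-* (𝟙 ∘ mate) (λ b x → 𝟙 (S x) * (𝟙 (o x e) * 𝟙 (o x b)))) ⟨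
        M + # v                                         ∎
        where
        t : Fin n → Fin n → ℕ
        t b x = 𝟙 (mate b) * (𝟙 (S x) * (𝟙 (o x e) * 𝟙 (o x b)))
        t≥1 : ∀ b x → mate b ≡ true → S x ≡ true → o x e ≡ true → o x b ≡ true → 1 ≤ t b x
        t≥1 b x mb Sx xe xb rewrite mb | Sx | xe | xb = ℕ.≤-refl
        pointwise : ∀ x → 𝟙 (S x) * 𝟙 (o x e) ≤ sum (λ b → t b x) + 𝟙 (v x)
        pointwise x = by (S x) (o x e) (v x) refl refl refl
          where
          by : ∀ s p q → S x ≡ s → o x e ≡ p → v x ≡ q → 𝟙 s * 𝟙 p ≤ sum (λ b → t b x) + 𝟙 q
          by false p     q     Sx xe vx = z≤n
          by true  false q     Sx xe vx = z≤n
          by true  true  true  Sx xe vx = ℕ.m≤n+m 1 _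
          by true  true  false Sx xe vx = let b , mb , xb = h x Sx xe vx in
            ℕ.≤-trans (t≥1 b x mb Sx xe xb)
              (ℕ.≤-trans (term≤sum (λ b → t b x) b) (ℕ.m≤m+n _ 0))

      -- This is `pair-bound` for `e` and `b`, summed over the mates `b`.
      A0 : # mate * # S + M ≤ # mate * (degS e + (D + 147)) + Q
      A0 = begin
        # mate * # S + M
          ≡⟨ cong (_+ M) (*-distribʳ-sum (# S) (𝟙 ∘ mate)) ⟩
        sum (λ b → 𝟙 (mate b) * # S) + M
          ≡⟨ ∑-distrib-+ (λ b → 𝟙 (mate b) * # S) (λ b → 𝟙 (mate b) * mult e b) ⟨
        sum (λ b → 𝟙 (mate b) * # S + 𝟙 (mate b) * mult e b)
          ≤⟨ sum-mono pointwise ⟩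
        sum (λ b → 𝟙 (mate b) * (degS e + (D + 147)) + 𝟙 (mate b) * degS b)
          ≡⟨ ∑-distrib-+ (λ b → 𝟙 (mate b) * (degS e + (D + 147))) (λ b → 𝟙 (mate b) * degS b) ⟩
        sum (λ b → 𝟙 (mate b) * (degS e + (D + 147))) + Q
          ≡⟨ cong (_+ Q) (*-distribʳ-sum (degS e + (D + 147)) (𝟙 ∘ mate)) ⟨
        # mate * (degS e + (D + 147)) + Q ∎
        where
        eq : ∀ x y k → 1 * (x + k) + 1 * y ≡ x + y + k
        eq = solve-∀
        pointwise : ∀ b → 𝟙 (mate b) * # S + 𝟙 (mate b) * mult e b
                        ≤ 𝟙 (mate b) * (degS e + (D + 147)) + 𝟙 (mate b) * degS b
        pointwise b with mate b in mb
        ... | false = z≤n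
        ... | true  = let (x , gx , xe , xb) , b≢e = true⇒ (mate? b) mb in
          ℕ.≤-trans (ℕ.≤-reflexive (cong₂ _+_ (ℕ.*-identityˡ (# S)) (ℕ.*-identityˡ (mult e b))))
            (ℕ.≤-trans (pair-bound x e b gx xe xb b≢e)
              (ℕ.≤-reflexive (sym (eq (degS e) (degS b) (D + 147)))))

      -- By minimality, every loner contributes at least `degS e` to the sum over the core.
      A3 : Q + # loner * degS e ≤ sum (λ b → 𝟙 (core b) * degS b)
      A3 = begin
        Q + # loner * degS e
          ≡⟨ cong (Q +_) (*-distribʳ-sum (degS e) (𝟙 ∘ loner)) ⟩
        Q + sum (λ b → 𝟙 (loner b) * degS e)
          ≡⟨ ∑-distrib-+ (λ b → 𝟙 (mate b) * degS b) (λ b → 𝟙 (loner b) * degS e) ⟨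
        sum (λ b → 𝟙 (mate b) * degS b + 𝟙 (loner b) * degS e)
          ≤⟨ sum-mono pointwise ⟩
        sum (λ b → 𝟙 (core b) * degS b) ∎
        where
        pointwise : ∀ b → 𝟙 (mate b) * degS b + 𝟙 (loner b) * degS e ≤ 𝟙 (core b) * degS b
        pointwise b with core b in cb | mate b in mb
        ... | true  | true  = ℕ.≤-reflexive (ℕ.+-identityʳ _)
        ... | true  | false = ℕ.*-monoʳ-≤ 1 (e-min b cb)
        ... | false | false = z≤n
        ... | false | true  = case trans (sym cb) (mate⇒core b mb) of λ ()

      A4 : (# mate + # loner) * degS e ≤ sum (λ b → 𝟙 (core b) * degS b)
      A4 = begin
        (# mate + # loner) * degS e        ≡⟨ cong (_* degS e) #core ⟨
        # core * degS e                    ≡⟨ *-distribʳ-sum (degS e) (𝟙 ∘ core) ⟩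
        sum (λ b → 𝟙 (core b) * degS e)    ≤⟨ sum-mono pointwise ⟩
        sum (λ b → 𝟙 (core b) * degS b)    ∎
        where
        pointwise : ∀ b → 𝟙 (core b) * degS e ≤ 𝟙 (core b) * degS b
        pointwise b with core b in cb
        ... | true  = ℕ.*-monoʳ-≤ 1 (e-min b cb)
        ... | false = z≤n

      no-minimum : ⊥
      no-minimum = core-arith (# S) D (# bad) (# poor) (degS e) (# mate) (# loner) M Q
        large few-bad few-poor
        1≤mate 1≤loner (subst (6 ≤_) #core 6≤core)
        A0 (degS-e bad via-good) (λ ≡1 → degS-e poor (via-poor ≡1))
        (sum-*-bound (𝟙 ∘ mate) degS D degS≤D)
        (ℕ.≤-trans A3 sumCore-degS≤)
        (ℕ.≤-trans A4 sumCore-degS≤)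

    not-large : ⊥
    not-large = let e , core-e , e-min = minimise core degS (#≥1⇒∃ core (ℕ.≤-trans (s≤s z≤n) 6≤core))
                 in no-minimum e core-e e-min

  clique-size : 2 * # S ≤ 5 * D + 1064
  clique-size = ℕ.≮⇒≥ λ big → not-large (subst (_≤ 2 * # S) (sym (ℕ.+-suc (5 * D) 1064)) big)

-- Orientations of outdegree at most two

sum-δ : ∀ {n} (f : Fin n → ℕ) a → sum (λ x → f x * 𝟙 (does (a ≟ x))) ≡ f a
sum-δ f a = trans (sum-single _ a off) at
  where
  off : ∀ x → x ≢ a → f x * 𝟙 (does (a ≟ x)) ≡ 0
  off x x≢a rewrite dec-false (a ≟ x) (x≢a ∘ sym) = ℕ.*-zeroʳ (f x)
  at : f a * 𝟙 (does (a ≟ a)) ≡ f a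
  at rewrite dec-true (a ≟ a) refl = ℕ.*-identityʳ (f a)

#-≟ : ∀ {n} (a : Fin n) → # (λ x → does (a ≟ x)) ≡ 1
#-≟ a = trans (sum-cong-≗ λ x → sym (ℕ.*-identityˡ (𝟙 (does (a ≟ x))))) (sum-δ (λ _ → 1) a)

-- Hakimi's theorem for outdegree 2: an orientation of least total excess Σ (outdeg ∸ 2) has no
-- excess, as otherwise reversing a trail to a vertex of outdegree at most 1 would reduce it, or the
-- vertices reachable from an overfull one would span too many edges.
module Orientation {n m} (lo hi : Fin m → Fin n) (lo≢hi : ∀ e → lo e ≢ hi e) where

  tail head : (Fin m → Bool) → Fin m → Fin n
  tail σ e = if σ e then lo e else hi e
  head σ e = if σ e then hi e else lo e

  flip : (Fin m → Bool) → Fin m → Fin m → Bool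
  flip σ e f = if does (f ≟ e) then not (σ f) else σ f

  outdeg : (Fin m → Bool) → Fin n → ℕ
  outdeg σ v = # λ e → does (tail σ e ≟ v)

  excess : (Fin m → Bool) → ℕ
  excess σ = sum λ v → outdeg σ v ∸ 2

  head≢tail : ∀ σ e → head σ e ≢ tail σ e
  head≢tail σ e with σ e
  ... | true  = lo≢hi e ∘ sym
  ... | false = lo≢hi e

  flip-≢ : ∀ σ {e f} → f ≢ e → flip σ e f ≡ σ f
  flip-≢ σ {e} {f} f≢e rewrite dec-false (f ≟ e) f≢e = refl

  tail-flip : ∀ σ e → tail (flip σ e) e ≡ head σ e
  tail-flip σ e rewrite dec-true (e ≟ e) refl with σ e
  ... | true  = refl
  ... | false = refl

  -- Away from `e` the two counts agree. Terms are added on both sides because subtraction of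
  -- naturals truncates.
  outdeg-flip : ∀ σ e x → outdeg (flip σ e) x + 𝟙 (does (tail σ e ≟ x))
                        ≡ outdeg σ x + 𝟙 (does (head σ e ≟ x))
  outdeg-flip σ e x = begin
    outdeg (flip σ e) x + t                                   ≡⟨ cong (_+ t) (#-∖ T′ e) ⟩
    𝟙 (does (tail (flip σ e) e ≟ x)) + # (T′ ∖ e) + t         ≡⟨ cong₂ (λ a b → a + b + t) at off ⟩
    h + # (T₀ ∖ e) + t                                        ≡⟨ eq h (# (T₀ ∖ e)) t ⟩
    t + # (T₀ ∖ e) + h                                        ≡⟨ cong (_+ h) (#-∖ T₀ e) ⟨
    outdeg σ x + h                                            ∎
    where
    open ≡-Reasoning
    T₀ T′ : Fin m → Bool
    T₀ f = does (tail σ f ≟ x)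
    T′ f = does (tail (flip σ e) f ≟ x)
    t h : ℕ
    t = 𝟙 (does (tail σ e ≟ x))
    h = 𝟙 (does (head σ e ≟ x))
    eq : ∀ a b c → a + b + c ≡ c + b + a
    eq = solve-∀
    at : 𝟙 (does (tail (flip σ e) e ≟ x)) ≡ h
    at = cong (λ y → 𝟙 (does (y ≟ x))) (tail-flip σ e)
    off : # (T′ ∖ e) ≡ # (T₀ ∖ e)
    off = sum-cong-≗ λ f → cong 𝟙 (same f)
      where
      same : ∀ f → (T′ ∖ e) f ≡ (T₀ ∖ e) f
      same f with f ≟ e
      ... | yes _ = trans (∧-zeroʳ _) (sym (∧-zeroʳ _))
      ... | no  _ = refl

  -- The index only bounds the length, so it can serve as the recursion measure of `improve` even
  -- when a trail is shortened.
  Trail : (Fin m → Bool) → ℕ → Fin n → Fin n → Set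
  Trail σ zero    x u = x ≡ u
  Trail σ (suc k) x u = x ≡ u ⊎ ∃ λ e → tail σ e ≡ x × Trail σ k (head σ e) u

  weaken : ∀ σ k {x u} → Trail σ k x u → Trail σ (suc k) x u
  weaken σ zero    x≡u                 = inj₁ x≡u
  weaken σ (suc k) (inj₁ x≡u)          = inj₁ x≡u
  weaken σ (suc k) (inj₂ (e , te , p)) = inj₂ (e , te , weaken σ k p)

  snoc : ∀ σ k {x} e → Trail σ k x (tail σ e) → Trail σ (suc k) x (head σ e)
  snoc σ zero    e refl                = inj₂ (e , refl , refl)
  snoc σ (suc k) e (inj₁ refl)         = inj₂ (e , refl , inj₁ refl)
  snoc σ (suc k) e (inj₂ (f , tf , p)) = inj₂ (f , tf , snoc σ k e p)

  -- A trail that avoids `e` survives the reversal. Otherwise the part after its last use of `e`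
  -- survives, and that part starts at `head σ e`.
  reroute : ∀ σ e k {x u} → Trail σ k x u →
            Trail (flip σ e) k x u ⊎ Trail (flip σ e) k (head σ e) u
  reroute σ e zero    x≡u        = inj₁ x≡u
  reroute σ e (suc k) (inj₁ x≡u) = inj₁ (inj₁ x≡u)
  reroute σ e (suc k) (inj₂ (f , tf , p)) with f ≟ e | reroute σ e k p
  ... | _        | inj₂ q = inj₂ (weaken _ k q)
  ... | yes refl | inj₁ q = inj₂ (weaken _ k q)
  ... | no f≢e   | inj₁ q = inj₁ (inj₂ (f ,
    trans (cong (λ b → if b then lo f else hi f) (flip-≢ σ f≢e)) tf ,
    subst (λ b → Trail (flip σ e) k (if b then hi f else lo f) _) (sym (flip-≢ σ f≢e)) q))

  -- Reverse the trail one edge at a time. Reversing its first edge lowers the excess at `v`; either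
  -- the head `w` has room for one more outgoing arc, or the surplus moves to `w` and the shorter
  -- trail is treated in the same way.
  improve : ∀ k σ v u → 3 ≤ outdeg σ v → outdeg σ u ≤ 1 → Trail σ k v u →
            ∃ λ σ′ → excess σ′ < excess σ
  improve zero    σ v u v≥3 u≤1 refl        = contradiction (ℕ.≤-trans v≥3 u≤1) λ { (s≤s ()) }
  improve (suc k) σ v u v≥3 u≤1 (inj₁ refl) = contradiction (ℕ.≤-trans v≥3 u≤1) λ { (s≤s ()) }
  improve (suc k) σ v u v≥3 u≤1 (inj₂ (e , refl , p)) = split (outdeg σ w ℕ.≤? 1)
    where
    w : Fin n
    w = head σ e
    σ′ : Fin m → Bool
    σ′ = flip σ e
    δᵥ δᵤ : Fin n → ℕ
    δᵥ x = 𝟙 (does (v ≟ x))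
    δᵤ x = 𝟙 (does (w ≟ x))
    changed : ∀ x → outdeg σ′ x + δᵥ x ≡ outdeg σ x + δᵤ x
    changed = outdeg-flip σ e
    at-w : outdeg σ′ w ≡ suc (outdeg σ w)
    at-w with changed w
    ... | eq rewrite dec-true (w ≟ w) refl | dec-false (v ≟ w) (head≢tail σ e ∘ sym) =
      trans (sym (ℕ.+-identityʳ _)) (trans eq (ℕ.+-comm _ 1))
    off-w : ∀ x → x ≢ w → outdeg σ′ x + δᵥ x ≡ outdeg σ x
    off-w x x≢w with changed x
    ... | eq rewrite dec-false (w ≟ x) (x≢w ∘ sym) = trans eq (ℕ.+-identityʳ _)
    -- The bound `3 ≤ b` keeps truncated subtraction exact: at `b = 2` the excess would not drop.
    drop-v : ∀ {a b} → 3 ≤ b → a + 1 ≡ b → a ∸ 2 + 1 ≡ b ∸ 2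
    drop-v {a} 3≤b refl with a
    ... | suc (suc a′) = refl
    ... | 0 = contradiction 3≤b λ { (s≤s ()) }
    ... | 1 = contradiction 3≤b λ { (s≤s (s≤s ())) }
    excess-off : ∀ x → x ≢ w → (outdeg σ′ x ∸ 2) + δᵥ x ≡ outdeg σ x ∸ 2
    excess-off x x≢w with v ≟ x | off-w x x≢w
    ... | yes refl | eq = drop-v v≥3 eq
    ... | no  _    | eq = trans (ℕ.+-identityʳ _) (cong (_∸ 2) (trans (sym (ℕ.+-identityʳ _)) eq))
    δᵥw : δᵥ w ≡ 0
    δᵥw rewrite dec-false (v ≟ w) (head≢tail σ e ∘ sym) = refl
    sum-δᵥ : sum (λ x → (outdeg σ′ x ∸ 2) + δᵥ x) ≡ excess σ′ + 1
    sum-δᵥ = trans (∑-distrib-+ (λ x → outdeg σ′ x ∸ 2) δᵥ) (cong (excess σ′ +_) (#-≟ v))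

    split : Dec (outdeg σ w ≤ 1) → ∃ λ σ″ → excess σ″ < excess σ
    split (yes w≤1) = σ′ , ℕ.≤-trans (ℕ.≤-reflexive (trans (ℕ.+-comm 1 _) (sym sum-δᵥ))) (sum-mono less)
      where
      less : ∀ x → (outdeg σ′ x ∸ 2) + δᵥ x ≤ outdeg σ x ∸ 2
      less x with x ≟ w
      ... | no  x≢w = ℕ.≤-reflexive (excess-off x x≢w)
      ... | yes x≡w = subst (λ y → (outdeg σ′ y ∸ 2) + δᵥ y ≤ outdeg σ y ∸ 2) (sym x≡w)
        (ℕ.≤-trans (ℕ.≤-reflexive (cong₂ (λ a b → (a ∸ 2) + b) at-w δᵥw))
          (ℕ.≤-trans (ℕ.≤-reflexive (trans (ℕ.+-identityʳ _) (ℕ.m≤n⇒m∸n≡0 (s≤s w≤1)))) z≤n))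
    -- Now `w` has outdegree at least 3 after the reversal, and the total excess has not grown, so a
    -- strict decrease from `σ′` is one from `σ`.
    split (no w≰1) with improve k σ′ w u w≥3 u≤1′ trail
      where
      w≥3 : 3 ≤ outdeg σ′ w
      w≥3 = subst (3 ≤_) (sym at-w) (s≤s (ℕ.≰⇒> w≰1))
      -- `u` differs from `w`, whose outdegree was at least 2, so it gains nothing.
      u≤1′ : outdeg σ′ u ≤ 1
      u≤1′ = ℕ.≤-trans (ℕ.m≤m+n _ (δᵥ u)) (ℕ.≤-trans (ℕ.≤-reflexive
        (off-w u λ u≡w → w≰1 (subst (λ y → outdeg σ y ≤ 1) u≡w u≤1))) u≤1)
      -- `p` already starts at `w`, so both outcomes of `reroute` are trails from `w`.
      trail : Trail σ′ k w u
      trail with reroute σ e k p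
      ... | inj₁ q = q
      ... | inj₂ q = q
    ... | σ″ , less = σ″ , ℕ.<-≤-trans less (ℕ.+-cancelʳ-≤ 1 _ _ (begin
      excess σ′ + 1                           ≡⟨ sum-δᵥ ⟨
      sum (λ x → (outdeg σ′ x ∸ 2) + δᵥ x)    ≤⟨ sum-mono same ⟩
      sum (λ x → (outdeg σ x ∸ 2) + δᵤ x)     ≡⟨ ∑-distrib-+ (λ x → outdeg σ x ∸ 2) δᵤ ⟩
      excess σ + sum δᵤ                       ≡⟨ cong (excess σ +_) (#-≟ w) ⟩
      excess σ + 1                            ∎))
      where
      open ℕ.≤-Reasoning
      same-w : (outdeg σ′ w ∸ 2) + δᵥ w ≤ (outdeg σ w ∸ 2) + δᵤ w
      same-w rewrite at-w | δᵥw | dec-true (w ≟ w) refl = ℕ.≤-reflexive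
        (trans (ℕ.+-identityʳ _) (trans (ℕ.+-∸-assoc 1 (ℕ.≰⇒> w≰1)) (ℕ.+-comm 1 _)))
      same : ∀ x → (outdeg σ′ x ∸ 2) + δᵥ x ≤ (outdeg σ x ∸ 2) + δᵤ x
      same x with x ≟ w
      ... | no  x≢w = ℕ.≤-trans (ℕ.≤-reflexive (excess-off x x≢w)) (ℕ.m≤m+n _ _)
      ... | yes x≡w = subst (λ y → (outdeg σ′ y ∸ 2) + δᵥ y ≤ (outdeg σ y ∸ 2) + δᵤ y) (sym x≡w) same-w

  module _ (sparse : ∀ V → 1 ≤ # V → # (λ e → V (lo e) ∧ V (hi e)) < 2 * # V) where

    -- N is the set of vertices not yet known to be reachable from v.
    find-deficient : ∀ σ v k N → # N ≤ k → N v ≡ false →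
      (∀ x → N x ≡ false → ∃ λ j → Trail σ j v x) →
      ∃ λ u → outdeg σ u ≤ 1 × ∃ λ j → Trail σ j v u
    find-deficient σ v k N #N≤k Nv reached
      with any? (λ u → (N u ≟ᵇ false) ×-dec (outdeg σ u ℕ.≤? 1))
         | any? (λ e → (N (tail σ e) ≟ᵇ false) ×-dec (N (head σ e) ≟ᵇ true))
    ... | yes (u , Nu , u≤1) | _ = u , u≤1 , reached u Nu
    ... | no _     | yes (e , Nt , Nh) = grow k #N≤k
      where
      grow : ∀ k → # N ≤ k → ∃ λ u → outdeg σ u ≤ 1 × ∃ λ j → Trail σ j v u
      grow zero    #N≤0 = contradiction (ℕ.≤-trans (#≥1 N Nh) #N≤0) λ ()
      grow (suc k) #N≤k = find-deficient σ v k (N ∖ head σ e)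
        (s≤s⁻¹ (subst (_≤ suc k) (#-∖-true N (head σ e) Nh) #N≤k))
        (cong (_∧ _) Nv) reached′
        where
        reached′ : ∀ x → (N ∖ head σ e) x ≡ false → ∃ λ j → Trail σ j v x
        reached′ x N∖x with x ≟ head σ e
        ... | yes refl = let j , p = reached (tail σ e) Nt in suc j , snoc σ j e p
        ... | no _     = reached x (trans (sym (∧-identityʳ (N x))) N∖x)
    -- The reached set `V` is closed under arcs and has all outdegrees at least 2. Every arc with
    -- tail in `V` stays inside, so `V` spans at least `2|V|` edges, against `sparse`.
    ... | no none≤1 | no closed = contradiction (sparse V (#≥1 V {v} (cong not Nv))) (ℕ.≤⇒≯ (begin
      2 * # V                                             ≡⟨ ℕ.*-comm 2 (# V) ⟩
      # V * 2                                             ≡⟨ *-distribʳ-sum 2 (𝟙 ∘ V) ⟩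
      sum (λ x → 𝟙 (V x) * 2)                             ≤⟨ sum-mono full ⟩
      sum (λ x → 𝟙 (V x) * outdeg σ x)
        ≡⟨ sum-swap-* (𝟙 ∘ V) (λ x e → 𝟙 (does (tail σ e ≟ x))) ⟩
      sum (λ e → sum (λ x → 𝟙 (V x) * 𝟙 (does (tail σ e ≟ x))))
        ≡⟨ sum-cong-≗ (λ e → sum-δ (𝟙 ∘ V) (tail σ e)) ⟩
      # (λ e → V (tail σ e))                              ≤⟨ sum-mono within ⟩
      # (λ e → V (lo e) ∧ V (hi e))                       ∎))
      where
      open ℕ.≤-Reasoning
      V : Fin n → Bool
      V = not ∘ N
      full : ∀ x → 𝟙 (V x) * 2 ≤ 𝟙 (V x) * outdeg σ x
      full x with N x in Nx
      ... | true  = z≤n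
      ... | false = ℕ.*-monoʳ-≤ 1 (ℕ.≰⇒> λ ≤1 → none≤1 (x , Nx , ≤1))
      within : ∀ e → 𝟙 (V (tail σ e)) ≤ 𝟙 (V (lo e) ∧ V (hi e))
      within e = by (σ e) λ Nt Nh → closed (e , Nt , Nh)
        where
        by : ∀ b → (N (if b then lo e else hi e) ≡ false → N (if b then hi e else lo e) ≡ true → ⊥) →
             𝟙 (V (if b then lo e else hi e)) ≤ 𝟙 (V (lo e) ∧ V (hi e))
        by true ¬leaves with N (lo e) | N (hi e) | ¬leaves
        ... | true  | _     | _ = z≤n
        ... | false | false | _ = ℕ.≤-refl
        ... | false | true  | ¬leaves′ = ⊥-elim (¬leaves′ refl refl)
        by false ¬leaves with N (lo e) | N (hi e) | ¬leaves
        ... | _     | true  | _ = z≤n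
        ... | false | false | _ = ℕ.≤-refl
        ... | true  | false | ¬leaves′ = ⊥-elim (¬leaves′ refl refl)

    -- Descent on a bound `k` for the excess, starting with every edge directed from `lo` to `hi`.
    orient : ∃ λ σ → ∀ v → outdeg σ v ≤ 2
    orient = go _ (λ _ → true) ℕ.≤-refl
      where
      go : ∀ k σ → excess σ ≤ k → ∃ λ σ → ∀ v → outdeg σ v ≤ 2
      go k σ ≤k with any? (λ v → 3 ℕ.≤? outdeg σ v)
      ... | no none = σ , λ v → ℕ.≮⇒≥ λ v≥3 → none (v , v≥3)
      ... | yes (v , v≥3) with find-deficient σ v (# others) others ℕ.≤-refl others-v start
        where
        others : Fin n → Bool
        others x = not (does (x ≟ v))
        others-v : others v ≡ false
        others-v = cong not (dec-true (v ≟ v) refl)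
        start : ∀ x → others x ≡ false → ∃ λ j → Trail σ j v x
        start x eq with x ≟ v
        ... | yes refl = 0 , refl
      ...   | u , u≤1 , j , p with improve j σ v u v≥3 u≤1 p
      ...     | σ′ , less = descend k ≤k
        where
        descend : ∀ k → excess σ ≤ k → ∃ λ σ → ∀ v → outdeg σ v ≤ 2
        descend zero    ≤0 = contradiction (ℕ.<-≤-trans less ≤0) λ ()
        descend (suc k) ≤k = go k σ′ (s≤s⁻¹ (ℕ.<-≤-trans less ≤k))

-- From graphs to orientations

open import Data.Integer.Base using (+_)

-- `_/_` reduces its fraction. Among unnormalised rationals the denominator `d` is kept, and the
-- order is integer cross-multiplication.
/<4⇒<4* : ∀ a d .{{_ : NonZero d}} → + a / d ℚ.< + 4 / 1 → a < 4 * d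
/<4⇒<4* a (suc d) h
  with *<* lt ← ℚᵘ.<-respˡ-≃ (ℚ.toℚᵘ-fromℚᵘ (mkℚᵘ (+ a) d)) (ℚ.toℚᵘ-mono-< h) =
  ℤ.drop‿+<+ (subst (ℤ._< + (4 * suc d)) (ℤ.*-identityʳ (+ a)) lt)

-- The unnormalised right side has denominator 2, and 1064 = 2 · 532.
≤⇒/≤ : ∀ w D → 2 * w ≤ 5 * D + 1064 → + w / 1 ℚ.≤ (+ 5 / 2) ℚ.* (+ D / 1) ℚ.+ + 532 / 1
≤⇒/≤ w D h = ℚ.toℚᵘ-cancel-≤ (ℚᵘ.≤-respˡ-≃ (ℚᵘ.≃-sym (ℚ.toℚᵘ-fromℚᵘ (mkℚᵘ (+ w) 0)))
  (ℚᵘ.≤-respʳ-≃ (ℚᵘ.≃-sym rhs) (*≤* (subst (+ w ℤ.* + 2 ℤ.≤_) (sym num) le))))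
  where
  rhs : toℚᵘ ((+ 5 / 2) ℚ.* (+ D / 1) ℚ.+ + 532 / 1)
      ℚᵘ.≃ mkℚᵘ (+ 5) 1 ℚᵘ.* mkℚᵘ (+ D) 0 ℚᵘ.+ mkℚᵘ (+ 532) 0
  rhs = ℚᵘ.≃-trans (ℚ.toℚᵘ-homo-+ ((+ 5 / 2) ℚ.* (+ D / 1)) (+ 532 / 1))
    (ℚᵘ.+-congˡ (mkℚᵘ (+ 532) 0) (ℚᵘ.≃-trans (ℚ.toℚᵘ-homo-* (+ 5 / 2) (+ D / 1))
      (ℚᵘ.*-congˡ {mkℚᵘ (+ 5) 1} (ℚ.toℚᵘ-fromℚᵘ (mkℚᵘ (+ D) 0)))))
  num : ((+ 5 ℤ.* + D) ℤ.* + 1 ℤ.+ + 532 ℤ.* + 2) ℤ.* + 1 ≡ + (5 * D + 1064)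
  num = trans (ℤ.*-identityʳ _) (cong (ℤ._+ + 1064)
    (trans (ℤ.*-identityʳ _) (sym (ℤ.pos-* 5 D))))
  le : + w ℤ.* + 2 ℤ.≤ + (5 * D + 1064)
  le = subst (ℤ._≤ + (5 * D + 1064)) (trans (cong +_ (ℕ.*-comm 2 w)) (ℤ.pos-* w 2)) (ℤ.+≤+ h)

∈-subsets : ∀ {n} (p : Subset n) → p ∈ subsets n
∈-subsets Vec.[]              = here refl
∈-subsets (true  Vec.∷ p) = ∈-++⁺ˡ (∈-map⁺ _ (∈-subsets p))
∈-subsets {suc n} (false Vec.∷ p) = ∈-++⁺ʳ (List.map (inside Vec.∷_) (subsets n)) (∈-map⁺ _ (∈-subsets p))

∣∣≡# : ∀ {n} (p : Subset n) → ∣ p ∣ ≡ # (Vec.lookup p)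
∣∣≡# Vec.[]          = refl
∣∣≡# (true  Vec.∷ p) = cong suc (∣∣≡# p)
∣∣≡# (false Vec.∷ p) = ∣∣≡# p

∣tabulate∣ : ∀ {n} (f : Fin n → Bool) → ∣ tabulate f ∣ ≡ # f
∣tabulate∣ f = trans (∣∣≡# (tabulate f)) (sum-cong-≗ λ i → cong 𝟙 (lookup∘tabulate f i))

∈-tabulate⁺ : ∀ {n} (f : Fin n → Bool) {i} → f i ≡ true → i ∈ˢ tabulate f
∈-tabulate⁺ f {i} fi = lookup⇒[]= i _ (trans (lookup∘tabulate f i) fi)

∈-tabulate⁻ : ∀ {n} (f : Fin n → Bool) {i} → i ∈ˢ tabulate f → f i ≡ true
∈-tabulate⁻ f {i} i∈ = trans (sym (lookup∘tabulate f i)) ([]=⇒lookup i∈)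

module _ {n} (G : Graph n) where
  open Graph G

  averageDegree≤mad : (H : NonemptySubgraph G) → averageDegree G H ℚ.≤ mad G
  averageDegree≤mad (subgraph V E s ne) = Extremaℚ.v≤max⁺ ℚ.0ℚ _ (inj₂ (Any.map⁺
    (Any.mapMaybe⁺ _ _ (Any.map⁺ (lose (∈-cartesianProduct⁺ (∈-subsets V) (∈-subsets E))
      (listed (isSubgraph? G V E ×-dec nonempty? V)))))))
    where
    -- The decision may supply other proofs than `s` and `ne`. The average degree is the same, since
    -- `_/_` takes the nonzero proof irrelevantly.
    listed : (d : Dec (IsSubgraph G V E × Nonempty V)) →
             MaybeAny (λ H → averageDegree G (subgraph V E s ne) ℚ.≤ averageDegree G H)
                      (Maybe.map (λ (s , ne) → subgraph V E s ne) (dec⇒maybe d))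
    listed (yes _)  = just ℚ.≤-refl
    listed (no ¬sn) = contradiction (s , ne) ¬sn

  lo hi : Fin (length (edges G)) → Fin n
  lo e = proj₁ (lookup (edges G) e)
  hi e = proj₂ (lookup (edges G) e)

  edge-spec : ∀ e → lo e <ᶠ hi e × lo e ~ hi e
  edge-spec e = proj₂ (∈-filter⁻ (λ (u , v) → (u Fin.<? v) ×-dec (u ~? v))
    {xs = cartesianProduct (allFin n) (allFin n)} (∈-lookup e))

  ~⇒edge : ∀ {u v} → u <ᶠ v → u ~ v → ∃ λ e → lo e ≡ u × hi e ≡ v
  ~⇒edge {u} {v} u<v u~v = index uv∈ ,
    sym (cong proj₁ (Any.lookup-index uv∈)) , sym (cong proj₂ (Any.lookup-index uv∈))
    where
    uv∈ : (u , v) ∈ edges G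
    uv∈ = ∈-filter⁺ _ (∈-cartesianProduct⁺ (∈-allFin u) (∈-allFin v)) (u<v , u~v)

  -- The average degree of the subgraph induced on `V` gives `2|E| < 4|V|`; cancel 2.
  mad<4⇒sparse : mad G ℚ.< + 4 / 1 → ∀ V → 1 ≤ # V → # (λ e → V (lo e) ∧ V (hi e)) < 2 * # V
  mad<4⇒sparse mad<4 V 1≤#V = ℕ.*-cancelˡ-< 2 _ _ (subst (2 * # E <_) (ℕ.*-assoc 2 2 (# V))
    (subst (λ k → 2 * # E < 4 * k) (∣tabulate∣ V) (subst (λ k → 2 * k < 4 * ∣ tabulate V ∣) (∣tabulate∣ E)
      (/<4⇒<4* (2 * ∣ tabulate E ∣) ∣ tabulate V ∣ {{∈⇒nonZero (proj₂ nonempty)}}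
        (ℚ.≤-<-trans (averageDegree≤mad (subgraph (tabulate V) (tabulate E) isSubgraph nonempty)) mad<4)))))
    where
    E : Fin (length (edges G)) → Bool
    E e = V (lo e) ∧ V (hi e)
    isSubgraph : IsSubgraph G (tabulate V) (tabulate E)
    isSubgraph e e∈ = let Ve = ∈-tabulate⁻ E e∈ in
      ∈-tabulate⁺ V (∧-conicalˡ (V (lo e)) _ Ve) , ∈-tabulate⁺ V (∧-conicalʳ (V (lo e)) _ Ve)
    nonempty : Nonempty (tabulate V)
    nonempty = let a , Va = #≥1⇒∃ V 1≤#V in a , ∈-tabulate⁺ V Va

  open Orientation lo hi (λ e lo≡hi → Fin.<⇒≢ (proj₁ (edge-spec e)) lo≡hi)

  module _ (σ : Fin (length (edges G)) → Bool) (σ≤2 : ∀ v → outdeg σ v ≤ 2) where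

    arc? : ∀ u v → Dec (∃ λ e → tail σ e ≡ u × head σ e ≡ v)
    arc? u v = any? λ e → (tail σ e ≟ u) ×-dec (head σ e ≟ v)
    o : Fin n → Fin n → Bool
    o u v = does (arc? u v)

    o⇒~ : ∀ {u v} → o u v ≡ true → v ~ u
    o⇒~ {u} {v} uv with true⇒ (arc? u v) uv
    ... | e , te , he with σ e
    ...   | true  rewrite sym te | sym he = ~-sym (proj₂ (edge-spec e))
    ...   | false rewrite sym te | sym he = proj₂ (edge-spec e)

    ordered⇒o : ∀ {u v} → u <ᶠ v → u ~ v → o u v ≡ true ⊎ o v u ≡ true
    ordered⇒o {u} {v} u<v u~v with ~⇒edge u<v u~v
    ... | e , refl , refl with σ e in eq
    ...   | true  = inj₁ (dec-true (arc? (lo e) (hi e)) (e ,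
      cong (if_then lo e else hi e) eq , cong (if_then hi e else lo e) eq))
    ...   | false = inj₂ (dec-true (arc? (hi e) (lo e)) (e ,
      cong (if_then lo e else hi e) eq , cong (if_then hi e else lo e) eq))

    ~⇒o : ∀ {u v} → u ~ v → o u v ≡ true ⊎ o v u ≡ true
    ~⇒o {u} {v} u~v with Fin.<-cmp u v
    ... | tri< u<v _ _ = ordered⇒o u<v u~v
    ... | tri≈ _ u≡v _ = contradiction u~v (~-irrefl u≡v)
    ... | tri> _ _ v<u with ordered⇒o v<u (~-sym u~v)
    ...   | inj₁ vu = inj₂ vu
    ...   | inj₂ uv = inj₁ uv

    -- Each out-neighbour `v` of `u` is charged to an arc from `u` to `v`, and an arc has only one
    -- head.
    o≤2 : ∀ u → # (o u) ≤ 2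
    o≤2 u = begin
      # (o u)                                              ≤⟨ sum-mono pointwise ⟩
      sum (λ v → sum (λ e → out e * 𝟙 (does (head σ e ≟ v))))
        ≡⟨ sum-swap-* out (λ e v → 𝟙 (does (head σ e ≟ v))) ⟨
      sum (λ e → out e * # (λ v → does (head σ e ≟ v)))
        ≡⟨ sum-cong-≗ (λ e → trans (cong (out e *_) (#-≟ (head σ e))) (ℕ.*-identityʳ (out e))) ⟩
      outdeg σ u                                           ≤⟨ σ≤2 u ⟩
      2                                                    ∎
      where
      open ℕ.≤-Reasoning
      out : Fin (length (edges G)) → ℕ
      out e = 𝟙 (does (tail σ e ≟ u))
      1≤ : ∀ e v → tail σ e ≡ u → head σ e ≡ v → 1 ≤ out e * 𝟙 (does (head σ e ≟ v))
      1≤ e v te he rewrite dec-true (tail σ e ≟ u) te | dec-true (head σ e ≟ v) he = ℕ.≤-refl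
      pointwise : ∀ v → 𝟙 (o u v) ≤ sum (λ e → out e * 𝟙 (does (head σ e ≟ v)))
      pointwise v with arc? u v
      ... | no  _             = z≤n
      ... | yes (e , te , he) = ℕ.≤-trans (1≤ e v te he)
        (term≤sum (λ e → out e * 𝟙 (does (head σ e ≟ v))) e)

    o⁻≤Δ : ∀ a → # (λ x → o x a) ≤ Δ G
    o⁻≤Δ a = begin
      # (λ x → o x a)            ≤⟨ sum-mono pointwise ⟩
      # (λ x → does (a ~? x))    ≡⟨ ∣tabulate∣ (λ x → does (a ~? x)) ⟨
      degree G a                 ≤⟨ v≤max⁺ 0 _ (inj₂ (lose (∈-map⁺ (degree G) (∈-allFin a)) ℕ.≤-refl)) ⟩
      Δ G                        ∎
      where
      open ℕ.≤-Reasoning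
      pointwise : ∀ x → 𝟙 (o x a) ≤ 𝟙 (does (a ~? x))
      pointwise x with o x a in xa
      ... | false = z≤n
      ... | true rewrite dec-true (a ~? x) (o⇒~ xa) = ℕ.≤-refl

    linked : ∀ p → IsClique (G ²) p → ∀ x y →
      Vec.lookup p x ≡ true → Vec.lookup p y ≡ true → x ≢ y → Link o x y
    linked p clique x y px py x≢y with clique x y (lookup⇒[]= x p px) (lookup⇒[]= y p py) x≢y
    ... | inj₁ x~y with ~⇒o x~y
    ...   | inj₁ xy = arc xy
    ...   | inj₂ yx = arc⁻ yx
    linked p clique x y px py x≢y | inj₂ ((z , x~z , _ , z~y , refl) , _) with ~⇒o x~z | ~⇒o z~y
    ... | inj₁ xz | inj₁ zy = path z xz zy
    ... | inj₁ xz | inj₂ yz = shareOut z xz yz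
    ... | inj₂ zx | inj₁ zy = shareIn z zx zy
    ... | inj₂ zx | inj₂ yz = path⁻ z yz zx

    oriented-clique-bound : ∀ D → Δ G ≤ D → ∀ p → IsClique (G ²) p → 2 * ∣ p ∣ ≤ 5 * D + 1064
    oriented-clique-bound D Δ≤D p clique = subst (λ k → 2 * k ≤ 5 * D + 1064) (sym (∣∣≡# p))
      (Counting.clique-size o (Vec.lookup p) D o≤2 (λ a → ℕ.≤-trans (o⁻≤Δ a) Δ≤D) (linked p clique))

  clique-bound : ∀ D → mad G ℚ.< + 4 / 1 → Δ G ≤ D →
                 ∀ p → IsClique (G ²) p → 2 * ∣ p ∣ ≤ 5 * D + 1064
  clique-bound D mad<4 = by (orient (mad<4⇒sparse mad<4))
    where
    by : (∃ λ σ → ∀ v → outdeg σ v ≤ 2) →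
         Δ G ≤ D → ∀ p → IsClique (G ²) p → 2 * ∣ p ∣ ≤ 5 * D + 1064
    by (σ , σ≤2) = oriented-clique-bound σ σ≤2 D

theorem2 : ∀ (D : ℕ) → .{{_ : NonZero D}} → ∀ {n : ℕ} (G : Graph n) →
    mad G ℚ.< + 4 / 1 → Δ G ℕ.≤ D →
    + ω (G ²) / 1 ℚ.≤ (+ 5 / 2) ℚ.* (+ D / 1) ℚ.+ + 532 / 1
theorem2 D G mad<4 Δ≤D = ≤⇒/≤ (ω (G ²)) D
  -- `z≤n` settles the base value 0 of the maximum in `ω`.
  (argmax-all id {P = λ k → 2 * k ≤ 5 * D + 1064} z≤n
    (All.map⁺ (All.map (λ {p} → clique-bound G D mad<4 Δ≤D p)
                       (All.all-filter (isClique? (G ²)) (subsets _)))))
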